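{- Let $\frac mn$ be a positive irreducible fraction ($m,n$ positive integers) and let $t$ be a positive integer with $2\le t\le \frac mn<t+1$. Then every faithful decomposition of $\frac mn$ has length at least $t+2$. Moreover, there are infinitely many faithful decompositions of $\frac mn$ of length exactly $t+2$.
   Context: A (fraction) decomposition of a positive rational $\frac mn$ is an expression $\frac mn=\frac{a_1}{b_1}+\cdots+\frac{a_k}{b_k}$ where $a_1,\dots,a_k$ are positive integers (so each $\frac{a_i}{b_i}$ is a positive rational) and $b_1,\dots,b_k$ are pairwise distinct positive integers; $k$ is its length. For a positive irreducible fraction $u=\frac mn$, such a decomposition is called faithful if for all integers $x_1,\dots,x_k$ with $0\le x_i\le a_i$, the number $v=\sum_{i=1}^k \frac{x_i}{b_i}$ does not lie in $\frac1n\mathbb Z=\{\frac{c}{n}:c\in\mathbb Z\}$ unless $v=u$ or $v=0$. -}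

module Defs where

open import Data.Nat using (ℕ; zero; suc; _≤_; _+_)
open import Data.Integer using (ℤ; +_)
open import Data.Rational using (ℚ; 0ℚ; _/_) renaming (_+_ to _+ℚ_)
open import Data.Product using (_×_; _,_; proj₁; proj₂; ∃)
open import Data.Sum using (_⊎_)
open import Data.Fin using (Fin)
open import Data.Vec using (Vec; []; _∷_; lookup)
open import Relation.Binary.PropositionalEquality using (_≡_)

-- The rational c / d for an integer c and a natural d.
-- Only ever applied with d ≥ 1 (enforced by hypotheses); the zero case is a junk value.
_÷_ : ℤ → ℕ → ℚ
c ÷ zero    = 0ℚ
c ÷ (suc d) = c / suc d

-- A candidate decomposition of length k: the list of pairs (a_i , b_i).
Terms : ℕ → Set
Terms k = Vec (ℕ × ℕ) k

value : ∀ {k} → Terms k → ℚ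
value []             = 0ℚ
value ((a , b) ∷ ds) = ((+ a) ÷ b) +ℚ value ds

subValue : ∀ {k} → Vec ℕ k → Terms k → ℚ
subValue []       []             = 0ℚ
subValue (x ∷ xs) ((a , b) ∷ ds) = ((+ x) ÷ b) +ℚ subValue xs ds

IsDecomposition : ℚ → ∀ {k} → Terms k → Set
IsDecomposition u {k} ds =
  (∀ (i : Fin k) → 1 ≤ proj₁ (lookup ds i)) ×
  (∀ (i : Fin k) → 1 ≤ proj₂ (lookup ds i)) ×
  (∀ (i j : Fin k) → proj₂ (lookup ds i) ≡ proj₂ (lookup ds j) → i ≡ j) ×
  value ds ≡ u

IsFaithful : (m n : ℕ) → ∀ {k} → Terms k → Set
IsFaithful m n {k} ds =
  ∀ (xs : Vec ℕ k) →
    (∀ (i : Fin k) → lookup xs i ≤ proj₁ (lookup ds i)) →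
    ∀ (c : ℤ) → subValue xs ds ≡ c ÷ n →
    subValue xs ds ≡ (+ m) ÷ n ⊎ subValue xs ds ≡ 0ℚ

{-# OPTIONS --safe #-}

-- Lower bound. In a faithful decomposition every a_i / b_i is less than 1, for otherwise 1 is a forbidden
-- subsum. If k ≤ t + 1, the deficits f_i = 1 - a_i / b_i have sum at most 1. Two indices whose denominators
-- have a common factor g ≥ 2 satisfy f_i + f_j > 1 - 1/g, since otherwise two multiples of 1/g add up to 1;
-- likewise f_i > 1/2 if b_i is not coprime to n. Moreover b_i ∤ a_i b_j, for otherwise a_i / b_i could be
-- completed to 1 with denominator b_j; hence every b_i coprime to n has common factors with two other b_j.
-- Applied to the smallest deficit, this leaves no room for a fourth index and forces n = 1, so that three
-- deficits with sum 1 remain; they would give pairwise coprime x, y, z ≥ 2 with xyz + 3 ≤ xy + yz + zx.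
--
-- Existence. If a / p is the first term, p coprime to n, and m / n - a / p = m′ / (n p), then any faithful
-- decomposition of m′ / (n p) extends to one of m / n: modulo (1/n) ℤ, the coefficient of 1/p is determined
-- by the rest. The first denominator p can be chosen arbitrarily large.

module Submission where

open import Defs
open import Data.Nat using (ℕ; zero; suc; pred; _≤_; _<_; _+_; _*_; _∸_; _/_; _%_; NonZero; s≤s; z≤n; >-nonZero; >-nonZero⁻¹)
open import Data.Nat.Properties
open import Data.Nat.Coprimality using (Coprime; coprime?; coprime-divisor; coprime-Bézout; 1-coprimeTo; gcd≡1⇒coprime) renaming (sym to coprime-sym)
open import Data.Nat.DivMod using (m≡m%n+[m/n]*n; m%n<n)
open import Data.Nat.GCD using (gcd; gcd[m,n]∣m; gcd[m,n]∣n; gcd-greatest; module Bézout)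
open import Data.Nat.Divisibility using (_∣_; divides; ∣-trans; ∣-refl; ∣-reflexive; _∣0; m∣m*n; n∣m*n; ∣m∣n⇒∣m+n; ∣m+n∣m⇒∣n; ∣1⇒≡1; >⇒∤; ∣⇒≤; ∣m⇒∣m*n; ∣n⇒∣m*n; *-cancelˡ-∣; *-cancelʳ-∣; *-monoˡ-∣; *-monoʳ-∣)
open import Data.Nat.Tactic.RingSolver using (solve-∀)
open import Data.Integer using (+_)
open import Data.Integer as ℤ using (ℤ)
import Data.Integer.Properties as ℤ
import Data.Integer.Tactic.RingSolver as ℤSolver
open import Data.Rational using () renaming (_≤_ to _≤ℚ_; _<_ to _<ℚ_)
open import Data.Rational using (0ℚ; fromℚᵘ) renaming (_+_ to _+ℚ_)
import Data.Rational.Properties as ℚ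
import Data.Rational.Unnormalised as ℚᵘ
import Data.Rational.Unnormalised.Properties as ℚᵘ
open import Data.Product using (_×_; _,_; proj₁; proj₂; ∃; ∃₂)
open import Data.Sum using (_⊎_; inj₁; inj₂) renaming (map to ⊎-map)
open import Data.Fin using (Fin; zero; suc)
open import Data.Fin.Properties using (any?) renaming (_≟_ to _≟F_)
open import Data.List using (List)
import Data.List as List
open import Data.List.Extrema.Nat using (max; xs≤max)
open import Data.List.Membership.Propositional using (_∉_)
open import Data.List.Membership.Propositional.Properties using (∈-map⁺)
import Data.List.Relation.Unary.All as All
open import Data.Vec using (Vec; []; _∷_; lookup; map; tabulate)
open import Data.Vec.Properties using (lookup∘tabulate; lookup-map)
open import Data.Vec.Functional using (updateAt)
open import Data.Vec.Functional.Properties using (updateAt-updates; updateAt-minimal)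
open import Algebra.Properties.Group ℚ.+-0-group using () renaming (∙-cancelˡ to +ℚ-cancelˡ)
open import Algebra.Properties.Semiring.Sum +-*-semiring using (sum; sum-cong-≗; ∑-distrib-+; sum-replicate-zero; *-distribʳ-sum)
open import Data.Empty using (⊥; ⊥-elim)
open import Function using (_∘_; const; it)
open import Relation.Nullary using (¬_; contradiction; yes; no; ¬?; _×-dec_)
open import Relation.Nullary.Decidable using (decidable-stable)
open import Relation.Binary.Definitions using (tri<; tri≈; tri>)
open import Relation.Binary.PropositionalEquality using (_≡_; _≢_; refl; sym; trans; cong; cong₂; subst; subst₂; ≢-sym; module ≡-Reasoning)

private variable
  k : ℕ

-- Fractions

÷-cong : ∀ c n d e .{{_ : NonZero n}} .{{_ : NonZero e}} → c ℤ.* + e ≡ d ℤ.* + n → c ÷ n ≡ d ÷ e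
÷-cong c (suc n) d (suc e) eq = ℚ.fromℚᵘ-cong {ℚᵘ.mkℚᵘ c n} {ℚᵘ.mkℚᵘ d e} (ℚᵘ.*≡* eq)

÷-injective : ∀ c n d e .{{_ : NonZero n}} .{{_ : NonZero e}} → c ÷ n ≡ d ÷ e → c ℤ.* + e ≡ d ℤ.* + n
÷-injective c (suc n) d (suc e) eq = ℚᵘ.drop-*≡* (ℚ.fromℚᵘ-injective {ℚᵘ.mkℚᵘ c n} {ℚᵘ.mkℚᵘ d e} eq)

÷-≤ : ∀ c n d e .{{_ : NonZero n}} .{{_ : NonZero e}} → c ÷ n ≤ℚ d ÷ e → c ℤ.* + e ℤ.≤ d ℤ.* + n
÷-≤ c (suc n) d (suc e) le = ℚᵘ.drop-*≤* (ℚᵘ.≤-respʳ-≃ (ℚ.toℚᵘ-fromℚᵘ (ℚᵘ.mkℚᵘ d e))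
  (ℚᵘ.≤-respˡ-≃ (ℚ.toℚᵘ-fromℚᵘ (ℚᵘ.mkℚᵘ c n)) (ℚ.toℚᵘ-mono-≤ le)))

÷-< : ∀ c n d e .{{_ : NonZero n}} .{{_ : NonZero e}} → c ÷ n <ℚ d ÷ e → c ℤ.* + e ℤ.< d ℤ.* + n
÷-< c (suc n) d (suc e) lt = ℚᵘ.drop-*<* (ℚᵘ.<-respʳ-≃ (ℚ.toℚᵘ-fromℚᵘ (ℚᵘ.mkℚᵘ d e))
  (ℚᵘ.<-respˡ-≃ (ℚ.toℚᵘ-fromℚᵘ (ℚᵘ.mkℚᵘ c n)) (ℚ.toℚᵘ-mono-< lt)))

÷-+ : ∀ c n d e .{{_ : NonZero n}} .{{_ : NonZero e}} →
      c ÷ n +ℚ d ÷ e ≡ (c ℤ.* + e ℤ.+ d ℤ.* + n) ÷ (n * e)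
÷-+ c (suc n) d (suc e) = ℚ.toℚᵘ-injective (ℚᵘ.≃-trans (ℚ.toℚᵘ-homo-+ (fromℚᵘ p) (fromℚᵘ q))
  (ℚᵘ.≃-trans (ℚᵘ.+-cong (ℚ.toℚᵘ-fromℚᵘ p) (ℚ.toℚᵘ-fromℚᵘ q)) (ℚᵘ.≃-sym (ℚ.toℚᵘ-fromℚᵘ (p ℚᵘ.+ q)))))
  where
  p = ℚᵘ.mkℚᵘ c n
  q = ℚᵘ.mkℚᵘ d e

0÷ : ∀ n → (+ 0) ÷ n ≡ 0ℚ
0÷ zero    = refl
0÷ (suc n) = ÷-cong (+ 0) (suc n) (+ 0) 1 refl

÷-congℕ : ∀ {s n t e} .{{_ : NonZero n}} .{{_ : NonZero e}} → s * e ≡ t * n → (+ s) ÷ n ≡ (+ t) ÷ e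
÷-congℕ {s} {n} {t} {e} eq = ÷-cong (+ s) n (+ t) e (trans (sym (ℤ.pos-* s e)) (trans (cong +_ eq) (ℤ.pos-* t n)))

÷-injectiveℕ : ∀ {s n t e} .{{_ : NonZero n}} .{{_ : NonZero e}} → (+ s) ÷ n ≡ (+ t) ÷ e → s * e ≡ t * n
÷-injectiveℕ {s} {n} {t} {e} eq =
  ℤ.+-injective (trans (ℤ.pos-* s e) (trans (÷-injective (+ s) n (+ t) e eq) (sym (ℤ.pos-* t n))))

÷-+-same : ∀ s t n .{{_ : NonZero n}} → (+ s) ÷ n +ℚ (+ t) ÷ n ≡ (+ (s + t)) ÷ n
÷-+-same s t n = trans (÷-+ (+ s) n (+ t) n) (÷-cong _ (n * n) (+ (s + t)) n (begin
  (+ s ℤ.* + n ℤ.+ + t ℤ.* + n) ℤ.* + n    ≡⟨ lemma (+ s) (+ t) (+ n) ⟩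
  (+ s ℤ.+ + t) ℤ.* (+ n ℤ.* + n)          ≡⟨ cong (+ (s + t) ℤ.*_) (sym (ℤ.pos-* n n)) ⟩
  + (s + t) ℤ.* + (n * n)                  ∎))
  where
  open ≡-Reasoning
  instance
    nn≢0 : NonZero (n * n)
    nn≢0 = m*n≢0 n n
  lemma : ∀ s t n → (s ℤ.* n ℤ.+ t ℤ.* n) ℤ.* n ≡ (s ℤ.+ t) ℤ.* (n ℤ.* n)
  lemma = ℤSolver.solve-∀

module _ (n p : ℕ) .{{_ : NonZero n}} .{{_ : NonZero p}} where

  private instance
    np≢0 : NonZero (n * p)
    np≢0 = m*n≢0 n p
    pnp≢0 : NonZero (p * (n * p))
    pnp≢0 = m*n≢0 p (n * p)

  -- Multiplying through by n p gives an integer equation in which the coefficient x of 1 / p can be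
  -- read modulo p; `÷-unsplit` is the converse.
  ÷-split : ∀ x e c → x ℤ.* + n ℤ.+ e ≡ c ℤ.* + p → x ÷ p +ℚ e ÷ (n * p) ≡ c ÷ n
  ÷-split x e c eq = trans (÷-+ x p e (n * p))
    (÷-cong _ (p * (n * p)) c n (begin
      (x ℤ.* + (n * p) ℤ.+ e ℤ.* + p) ℤ.* + n        ≡⟨ cong (λ z → (x ℤ.* z ℤ.+ e ℤ.* + p) ℤ.* + n) (ℤ.pos-* n p) ⟩
      (x ℤ.* (+ n ℤ.* + p) ℤ.+ e ℤ.* + p) ℤ.* + n    ≡⟨ regroup x (+ n) (+ p) e ⟩
      (x ℤ.* + n ℤ.+ e) ℤ.* (+ p ℤ.* + n)            ≡⟨ cong (ℤ._* (+ p ℤ.* + n)) eq ⟩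
      c ℤ.* + p ℤ.* (+ p ℤ.* + n)                    ≡⟨ regroup′ c (+ p) (+ n) ⟩
      c ℤ.* (+ p ℤ.* (+ n ℤ.* + p))                  ≡⟨ cong (λ z → c ℤ.* (+ p ℤ.* z)) (sym (ℤ.pos-* n p)) ⟩
      c ℤ.* (+ p ℤ.* + (n * p))                      ≡⟨ cong (c ℤ.*_) (sym (ℤ.pos-* p (n * p))) ⟩
      c ℤ.* + (p * (n * p))                          ∎))
    where
    open ≡-Reasoning
    regroup : ∀ x n p e → (x ℤ.* (n ℤ.* p) ℤ.+ e ℤ.* p) ℤ.* n ≡ (x ℤ.* n ℤ.+ e) ℤ.* (p ℤ.* n)
    regroup = ℤSolver.solve-∀
    regroup′ : ∀ c p n → c ℤ.* p ℤ.* (p ℤ.* n) ≡ c ℤ.* (p ℤ.* (n ℤ.* p))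
    regroup′ = ℤSolver.solve-∀

  -- Puts the remainder of a subsum in (1 / (n p)) ℤ, where the faithfulness of the remaining terms
  -- applies.
  ÷-remainder : ∀ x v c → x ÷ p +ℚ v ≡ c ÷ n → v ≡ (c ℤ.* + p ℤ.- x ℤ.* + n) ÷ (n * p)
  ÷-remainder x v c eq = +ℚ-cancelˡ (x ÷ p) _ _
    (trans eq (sym (÷-split x _ c (cancel x (+ n) (c ℤ.* + p)))))
    where
    cancel : ∀ x n y → x ℤ.* n ℤ.+ (y ℤ.- x ℤ.* n) ≡ y
    cancel = ℤSolver.solve-∀

  ÷-unsplit : ∀ x e c → x ÷ p +ℚ e ÷ (n * p) ≡ c ÷ n → x ℤ.* + n ℤ.+ e ≡ c ℤ.* + p
  ÷-unsplit x e c eq = begin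
    x ℤ.* + n ℤ.+ e                              ≡⟨ cong (λ z → x ℤ.* + n ℤ.+ z) e≡ ⟩
    x ℤ.* + n ℤ.+ (c ℤ.* + p ℤ.- x ℤ.* + n)      ≡⟨ cancel (x ℤ.* + n) (c ℤ.* + p) ⟩
    c ℤ.* + p                                    ∎
    where
    open ≡-Reasoning
    e≡ : e ≡ c ℤ.* + p ℤ.- x ℤ.* + n
    e≡ = ℤ.*-cancelʳ-≡ _ _ (+ (n * p))
           (÷-injective e (n * p) _ (n * p) (÷-remainder x (e ÷ (n * p)) c eq))
    cancel : ∀ x y → x ℤ.+ (y ℤ.- x) ≡ y
    cancel = ℤSolver.solve-∀

-- Extending faithful decompositions

multiple<⇒≡0 : ∀ {p y} → p ∣ y → y < p → y ≡ 0
multiple<⇒≡0 {y = zero}  _   _   = refl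
multiple<⇒≡0 {y = suc y} p∣y y<p = contradiction p∣y (>⇒∤ y<p)

faithful-unit : ∀ n → 1 ≤ n → IsFaithful 1 n ((1 , n) ∷ [])
faithful-unit n 1≤n (x ∷ []) x≤ c eq with x | x≤ zero
... | zero        | _        = inj₂ (trans (ℚ.+-identityʳ _) (0÷ n))
... | suc zero    | _        = inj₁ (ℚ.+-identityʳ _)
... | suc (suc _) | s≤s ()

module _ {m n m′ a p : ℕ} {ds : Terms k} (1≤n : 1 ≤ n) (a<p : a < p)
  (mp≡na+m′ : m * p ≡ n * a + m′) where

  private instance
    n≢0 : NonZero n
    n≢0 = >-nonZero 1≤n
    p≢0 : NonZero p
    p≢0 = >-nonZero (≤-trans (s≤s z≤n) a<p)

  private
    balance : + a ℤ.* + n ℤ.+ + m′ ≡ + m ℤ.* + p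
    balance = begin
      + a ℤ.* + n ℤ.+ + m′   ≡⟨ cong (ℤ._+ + m′) (sym (ℤ.pos-* a n)) ⟩
      + (a * n + m′)         ≡⟨ cong (λ z → + (z + m′)) (*-comm a n) ⟩
      + (n * a + m′)         ≡⟨ cong +_ (sym mp≡na+m′) ⟩
      + (m * p)              ≡⟨ ℤ.pos-* m p ⟩
      + m ℤ.* + p            ∎
      where open ≡-Reasoning

  value-cons : (+ a) ÷ p +ℚ (+ m′) ÷ (n * p) ≡ (+ m) ÷ n
  value-cons = ÷-split n p (+ a) (+ m′) (+ m) balance

  -- A common divisor of p and n divides m p and n a, hence m′, and it divides n p.
  coprime-cons : Coprime m′ (n * p) → Coprime p n
  coprime-cons cop {d} (d∣p , d∣n) =
    cop (∣m+n∣m⇒∣n (subst (d ∣_) mp≡na+m′ (∣n⇒∣m*n m d∣p)) (∣m⇒∣m*n a d∣n) , ∣m⇒∣m*n p d∣n)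

  -- The terms after the first contribute all of m′ / (n p) or nothing. In the first case p divides
  -- n (a - x), in the second n x. Since p is coprime to n, and a - x and x are less than p, x is a
  -- or 0.
  faithful-cons : Coprime m′ (n * p) → IsFaithful m′ (n * p) ds → IsFaithful m n ((a , p) ∷ ds)
  faithful-cons cop faithful (x ∷ xs) x≤a c eq
    with faithful xs (x≤a ∘ suc) _ (÷-remainder n p (+ x) (subValue xs ds) c eq)
  ... | inj₁ v≡ = inj₁ (trans (cong₂ (λ z v → (+ z) ÷ p +ℚ v) x≡a v≡) value-cons)
    where
    open ≡-Reasoning
    y = a ∸ x
    y+x≡a : y + x ≡ a
    y+x≡a = m∸n+n≡m (x≤a zero)
    move : ∀ X Y n e M p c → (Y ℤ.+ X) ℤ.* n ℤ.+ e ≡ M ℤ.* p → X ℤ.* n ℤ.+ e ≡ c ℤ.* p → n ℤ.* Y ≡ (M ℤ.- c) ℤ.* p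
    move X Y n e M p c eq₁ eq₂ = begin
      n ℤ.* Y                                               ≡⟨ lemma X Y n e ⟩
      ((Y ℤ.+ X) ℤ.* n ℤ.+ e) ℤ.- (X ℤ.* n ℤ.+ e)           ≡⟨ cong₂ ℤ._-_ eq₁ eq₂ ⟩
      M ℤ.* p ℤ.- c ℤ.* p                                   ≡⟨ lemma′ M c p ⟩
      (M ℤ.- c) ℤ.* p                                       ∎
      where
      lemma : ∀ X Y n e → n ℤ.* Y ≡ ((Y ℤ.+ X) ℤ.* n ℤ.+ e) ℤ.- (X ℤ.* n ℤ.+ e)
      lemma = ℤSolver.solve-∀
      lemma′ : ∀ M c p → M ℤ.* p ℤ.- c ℤ.* p ≡ (M ℤ.- c) ℤ.* p
      lemma′ = ℤSolver.solve-∀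
    -- Full sum minus subsum: m′ cancels and n (a - x) is left as a multiple of p.
    ny≡ : + n ℤ.* + y ≡ (+ m ℤ.- c) ℤ.* + p
    ny≡ = move (+ x) (+ y) (+ n) (+ m′) (+ m) (+ p) c
      (trans (cong (λ z → + z ℤ.* + n ℤ.+ + m′) y+x≡a) balance)
      (÷-unsplit n p (+ x) (+ m′) c (trans (cong ((+ x) ÷ p +ℚ_) (sym v≡)) eq))
    p∣ny : p ∣ n * y
    p∣ny = divides ℤ.∣ + m ℤ.- c ∣ (trans (sym (ℤ.abs-* (+ n) (+ y))) (trans (cong ℤ.∣_∣ ny≡) (ℤ.abs-* (+ m ℤ.- c) (+ p))))
    y≡0 : y ≡ 0
    y≡0 = multiple<⇒≡0 (coprime-divisor (coprime-cons cop) p∣ny) (≤-<-trans (m∸n≤m a x) a<p)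
    x≡a : x ≡ a
    x≡a = trans (cong (_+ x) (sym y≡0)) y+x≡a
  ... | inj₂ v≡ = inj₂ (trans (cong₂ (λ z v → (+ z) ÷ p +ℚ v) x≡0 v≡) (trans (ℚ.+-identityʳ _) (0÷ p)))
    where
    xn≡ : + x ℤ.* + n ≡ c ℤ.* + p
    xn≡ = trans (sym (ℤ.+-identityʳ _)) (÷-unsplit n p (+ x) (+ 0) c
      (trans (cong ((+ x) ÷ p +ℚ_) (trans (0÷ (n * p)) (sym v≡))) eq))
    p∣nx : p ∣ n * x
    p∣nx = divides ℤ.∣ c ∣ (trans (*-comm n x) (trans (sym (ℤ.abs-* (+ x) (+ n))) (trans (cong ℤ.∣_∣ xn≡) (ℤ.abs-* c (+ p)))))
    x≡0 : x ≡ 0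
    x≡0 = multiple<⇒≡0 (coprime-divisor (coprime-cons cop) p∣nx) (≤-<-trans (x≤a zero) a<p)

  decomposition-cons : 1 ≤ a → (∀ i → p < proj₂ (lookup ds i)) →
    IsDecomposition ((+ m′) ÷ (n * p)) ds → IsDecomposition ((+ m) ÷ n) ((a , p) ∷ ds)
  decomposition-cons 1≤a p<b (1≤as , 1≤bs , distinct , value≡) =
    (λ { zero → 1≤a ; (suc i) → 1≤as i }) ,
    (λ { zero → ≤-trans (s≤s z≤n) a<p ; (suc i) → 1≤bs i }) ,
    (λ { zero zero _ → refl
       ; zero (suc j) eq → contradiction eq (<⇒≢ (p<b j))
       ; (suc i) zero eq → contradiction (sym eq) (<⇒≢ (p<b i))
       ; (suc i) (suc j) eq → cong suc (distinct i j eq) }) ,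
    trans (cong ((+ a) ÷ p +ℚ_) value≡) value-cons

-- Existence of decompositions with t + 2 terms

m+1≡n*s⇒coprime : ∀ {m n} s → m + 1 ≡ n * s → Coprime m n
m+1≡n*s⇒coprime s eq {d} (d∣m , d∣n) = ∣1⇒≡1 (∣m+n∣m⇒∣n (subst (d ∣_) (sym eq) (∣m⇒∣m*n s d∣n)) d∣m)

-- The lower bound on the denominators serves the induction: those of a tail with value m′ / (n p)
-- exceed n p ≥ p, hence differ from p.
FaithfulAbove : (m n : ℕ) → Terms k → Set
FaithfulAbove m n ds = (∀ i → n < proj₂ (lookup ds i)) × IsDecomposition ((+ m) ÷ n) ds × IsFaithful m n ds

faithfulAbove-cons : ∀ {m n m′ a p} {ds : Terms k} → 1 ≤ n → n < p → 1 ≤ a → a < p → m * p ≡ n * a + m′ →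
  Coprime m′ (n * p) → FaithfulAbove m′ (n * p) ds → FaithfulAbove m n ((a , p) ∷ ds)
faithfulAbove-cons {m = m} {n = n} {p = p} 1≤n n<p 1≤a a<p eq cop (np<b , dec , faithful) =
  (λ { zero → n<p ; (suc i) → <-≤-trans n<p (≤-trans p≤np (<⇒≤ (np<b i))) }) ,
  decomposition-cons {m = m} 1≤n a<p eq 1≤a (λ i → ≤-<-trans p≤np (np<b i)) dec ,
  faithful-cons {m = m} 1≤n a<p eq cop faithful
  where
  p≤np : p ≤ n * p
  p≤np = m≤n*m p n {{>-nonZero 1≤n}}

-- m / n = s + 1 - 1 / n: the greedy choice n / (n + 1) leaves s - 1 / (n (n + 1)), which has the same shape,
-- and the case s = 0 is (n - 1) / n = (2n - 3) / (2n - 1) + 1 / (n (2n - 1)).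
sylvester : ∀ s {m n} → 2 ≤ n → m + 1 ≡ n * suc s → ∃ λ (ds : Terms (2 + s)) → FaithfulAbove m n ds
sylvester zero {m} {suc (suc n)} (s≤s (s≤s z≤n)) eq = _ ,
  (λ { zero → n<p ; (suc zero) → <-≤-trans n<p (m≤n*m p N) }) ,
  decomposition-cons {m = m} 1≤n a<p eq′ (s≤s z≤n) (λ { zero → p<Np })
    ( (λ { zero → s≤s z≤n }) , (λ { zero → s≤s z≤n }) , (λ { zero zero _ → refl }) , ℚ.+-identityʳ _) ,
  faithful-cons {m = m} 1≤n a<p eq′ (1-coprimeTo _) (faithful-unit _ (s≤s z≤n))
  where
  N = 2 + n
  p = 3 + (n + n)
  a = 1 + (n + n)
  1≤n : 1 ≤ N
  1≤n = s≤s z≤n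
  n<p : N < p
  n<p = s≤s (s≤s (s≤s (m≤m+n n n)))
  a<p : a < p
  a<p = m≤n+m (suc a) 1
  p<Np : p < N * p
  p<Np = m<m+n p (s≤s z≤n)
  m≡ : m ≡ suc n
  m≡ = +-cancelʳ-≡ 1 m (suc n) (trans eq (lemma n))
    where
    lemma : ∀ n → (2 + n) * 1 ≡ suc n + 1
    lemma = solve-∀
  eq′ : m * p ≡ N * a + 1
  eq′ rewrite m≡ = lemma n
    where
    lemma : ∀ n → suc n * (3 + (n + n)) ≡ (2 + n) * (1 + (n + n)) + 1
    lemma = solve-∀
sylvester (suc s) {m} {n@(suc _)} 2≤n eq =
  let ds , above = sylvester s (≤-trans 2≤n (m≤m*n n (suc n))) eq′ in
  (n , suc n) ∷ ds ,
  faithfulAbove-cons {m = m} (<⇒≤ 2≤n) ≤-refl (<⇒≤ 2≤n) ≤-refl balance (m+1≡n*s⇒coprime (suc s) eq′) above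
  where
  -- The numerator of s + 1 - 1 / (n (n + 1)); it is -1 modulo the denominator, hence coprime to it.
  m′ = pred (n * suc n * suc s)
  eq′ : m′ + 1 ≡ n * suc n * suc s
  eq′ = +-comm m′ 1
  balance : m * suc n ≡ n * n + m′
  balance = +-cancelʳ-≡ (suc n) _ _ (begin
    m * suc n + suc n              ≡⟨ lemma m n ⟩
    (m + 1) * suc n                ≡⟨ cong (_* suc n) eq ⟩
    n * suc (suc s) * suc n        ≡⟨ lemma′ n s ⟩
    n * suc n * suc s + n * suc n  ≡⟨ cong (_+ n * suc n) (sym eq′) ⟩
    m′ + 1 + n * suc n              ≡⟨ lemma″ n m′ ⟩
    n * n + m′ + suc n              ∎)
    where
    open ≡-Reasoning
    lemma : ∀ m n → m * suc n + suc n ≡ (m + 1) * suc n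
    lemma = solve-∀
    lemma′ : ∀ n s → n * suc (suc s) * suc n ≡ n * suc n * suc s + n * suc n
    lemma′ = solve-∀
    lemma″ : ∀ n k → k + 1 + n * suc n ≡ n * n + k + suc n
    lemma″ = solve-∀

-- An inverse p of r modulo n comes from Bézout; adding n (K + 1) to p and r (K + 1) to d makes p
-- exceed K and preserves r p - n d.
large-inverse : ∀ {r n} K → 1 ≤ r → 1 ≤ n → Coprime r n → ∃₂ λ p d → K < p × r * p ≡ n * d + 1
large-inverse {r} {n} K 1≤r 1≤n cop with coprime-Bézout cop
... | Bézout.+- x y eq = x + n * suc K , y + r * suc K ,
  ≤-trans (m≤n*m (suc K) n {{>-nonZero 1≤n}}) (m≤n+m (n * suc K) x) ,
  (begin
    r * (x + n * suc K)        ≡⟨ lemma r x n K ⟩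
    x * r + n * (r * suc K)    ≡⟨ cong (_+ n * (r * suc K)) (sym eq) ⟩
    1 + y * n + n * (r * suc K) ≡⟨ lemma′ r y n K ⟩
    n * (y + r * suc K) + 1    ∎)
  where
  open ≡-Reasoning
  lemma : ∀ r x n K → r * (x + n * suc K) ≡ x * r + n * (r * suc K)
  lemma = solve-∀
  lemma′ : ∀ r y n K → 1 + y * n + n * (r * suc K) ≡ n * (y + r * suc K) + 1
  lemma′ = solve-∀
-- Here Bézout makes x an inverse of -r modulo the modulus `suc n`, so x is multiplied by `n`, which
-- is -1 modulo `suc n`.
large-inverse {suc r} {suc n} K 1≤r 1≤n cop | Bézout.-+ x y eq = n * x + suc n * suc K , n * y + K + r * suc K ,
  ≤-trans (m≤n*m (suc K) (suc n)) (m≤n+m (suc n * suc K) (n * x)) ,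
  +-cancelʳ-≡ n _ _ (begin
    suc r * (n * x + suc n * suc K) + n              ≡⟨ lemma r n x K ⟩
    n * (1 + x * suc r) + suc r * suc n * suc K      ≡⟨ cong (λ z → n * z + suc r * suc n * suc K) eq ⟩
    n * (y * suc n) + suc r * suc n * suc K          ≡⟨ lemma′ r n y K ⟩
    suc n * (n * y + K + r * suc K) + 1 + n          ∎)
  where
  open ≡-Reasoning
  lemma : ∀ r n x K → suc r * (n * x + suc n * suc K) + n ≡ n * (1 + x * suc r) + suc r * suc n * suc K
  lemma = solve-∀
  lemma′ : ∀ r n y K → n * (y * suc n) + suc r * suc n * suc K ≡ suc n * (n * y + K + r * suc K) + 1 + n
  lemma′ = solve-∀

headDenominator : Terms k → ℕ
headDenominator []            = 0
headDenominator ((_ , b) ∷ _) = b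

-- With s = t - 1 and r = n (t + 1) - m, the first term is 1 - d / p where r p = n d + 1: it leaves
-- the remainder s + 1 - 1 / (n p) expected by sylvester.
unbounded-decompositions : ∀ {m n} s r K → 1 ≤ n → Coprime m n → 1 ≤ r → r ≤ n → m + r ≡ n * (2 + s) →
  ∃ λ (ds : Terms (3 + s)) → K < headDenominator ds × IsDecomposition ((+ m) ÷ n) ds × IsFaithful m n ds
unbounded-decompositions {m} {n} s r K 1≤n cop 1≤r r≤n m+r≡
  -- The summand n in the bound ensures p > n ≥ 1.
  with large-inverse (K + n) 1≤r 1≤n coprime-r
  where
  coprime-r : Coprime r n
  coprime-r {d} (d∣r , d∣n) = cop (∣m+n∣m⇒∣n (subst (d ∣_) (trans (sym m+r≡) (+-comm m r)) (∣m⇒∣m*n (2 + s) d∣n)) d∣r , d∣n)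
... | p , d , K+n<p , rp≡ = let ds , n<b , dec , faithful = sylvester s 2≤np eq′ in
  (p ∸ d , p) ∷ ds ,
  ≤-<-trans (m≤m+n K n) K+n<p ,
  decomposition-cons {m = m} 1≤n a<p balance (m<n⇒0<n∸m d<p) (λ i → ≤-<-trans (m≤n*m p n {{>-nonZero 1≤n}}) (n<b i)) dec ,
  faithful-cons {m = m} 1≤n a<p balance (m+1≡n*s⇒coprime (suc s) eq′) faithful
  where
  n<p : n < p
  n<p = ≤-<-trans (m≤n+m n K) K+n<p
  1<p : 1 < p
  1<p = ≤-<-trans 1≤n n<p
  1≤d : 1 ≤ d
  -- d = 0 would give r p = 1, although p > 1.
  1≤d = n≢0⇒n>0 λ { refl → <⇒≢ (<-≤-trans 1<p (m≤n*m p r {{>-nonZero 1≤r}})) (sym (trans rp≡ (cong (_+ 1) (*-zeroʳ n)))) }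
  d<p : d < p
  d<p = *-cancelˡ-< n d p (≤-trans (≤-reflexive (trans (+-comm 1 (n * d)) (sym rp≡))) (*-monoˡ-≤ p r≤n))
  a<p : p ∸ d < p
  a<p = ∸-monoʳ-< {p} {d} {0} 1≤d (<⇒≤ d<p)
  2≤np : 2 ≤ n * p
  2≤np = ≤-trans 1<p (m≤n*m p n {{>-nonZero 1≤n}})
  m′ = pred (n * p * suc s)
  eq′ : m′ + 1 ≡ n * p * suc s
  eq′ = trans (+-comm m′ 1) (suc-pred (n * p * suc s) {{>-nonZero (≤-trans (<⇒≤ 2≤np) (m≤m*n (n * p) (suc s)))}})
  balance : m * p ≡ n * (p ∸ d) + m′
  balance = +-cancelʳ-≡ (n * d + 1) _ _ (begin
    m * p + (n * d + 1)                  ≡⟨ cong (_+_ (m * p)) (sym rp≡) ⟩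
    m * p + r * p                        ≡⟨ sym (*-distribʳ-+ p m r) ⟩
    (m + r) * p                          ≡⟨ cong (_* p) m+r≡ ⟩
    n * (2 + s) * p                      ≡⟨ lemma n s p ⟩
    n * p + n * p * suc s                ≡⟨ cong₂ (λ u v → n * u + v) (sym (m∸n+n≡m (<⇒≤ d<p))) (sym eq′) ⟩
    n * (p ∸ d + d) + (m′ + 1)           ≡⟨ lemma′ n (p ∸ d) d m′ ⟩
    n * (p ∸ d) + m′ + (n * d + 1)       ∎)
    where
    open ≡-Reasoning
    lemma : ∀ n s p → n * (2 + s) * p ≡ n * p + n * p * suc s
    lemma = solve-∀
    lemma′ : ∀ n a d k → n * (a + d) + (k + 1) ≡ n * a + k + (n * d + 1)
    lemma′ = solve-∀

-- Three deficits with sum 1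

coprime-* : ∀ {x m n} → Coprime x m → Coprime x n → Coprime x (m * n)
coprime-* cop₁ cop₂ (d∣x , d∣mn) =
  cop₂ (d∣x , coprime-divisor (λ (e∣d , e∣m) → cop₁ (∣-trans e∣d d∣x , e∣m)) d∣mn)

coprime-∣-* : ∀ {x y z} → Coprime x y → x ∣ z → y ∣ z → x * y ∣ z
coprime-∣-* {x} {y} cop (divides q refl) y∣qx =
  subst (_∣ q * x) (*-comm y x) (*-monoˡ-∣ x (coprime-divisor (coprime-sym cop) (subst (y ∣_) (*-comm q x) y∣qx)))

¬coprime⇒common-factor : ∀ {m n} → 1 ≤ m → ¬ Coprime m n → ∃ λ g → 2 ≤ g × g ∣ m × g ∣ n
¬coprime⇒common-factor {m} {n} 1≤m ¬cop with gcd m n in eq | gcd[m,n]∣m m n | gcd[m,n]∣n m n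
... | zero        | g∣m | _   = contradiction g∣m (>⇒∤′ 1≤m)
  where
  >⇒∤′ : ∀ {m} → 1 ≤ m → ¬ (0 ∣ m)
  >⇒∤′ 1≤m (divides q refl) = <⇒≢ 1≤m (sym (*-zeroʳ q))
... | suc zero    | _   | _   = ⊥-elim (¬cop (gcd≡1⇒coprime eq))
... | suc (suc g) | g∣m | g∣n = suc (suc g) , s≤s (s≤s z≤n) , g∣m , g∣n

-- With x = 2 + a, y = x + 1 + b and z = y + 1 + c, the difference of the two sides is a polynomial
-- in a, b, c with nonnegative coefficients. Equality holds at (2, 3, 4).
increasing-products : ∀ {x y z} → 2 ≤ x → x < y → y < z → x * y + y * z + z * x ≤ x * y * z + 2
increasing-products {x} {y} {z} 2≤x x<y y<z
  with m≤n⇒∃[o]m+o≡n 2≤x | m≤n⇒∃[o]m+o≡n x<y | m≤n⇒∃[o]m+o≡n y<z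
... | a , refl | b , refl | c , refl = ≤-trans (m≤m+n _ _) (≤-reflexive (lemma a b c))
  where
  lemma : ∀ a b c → (2 + a) * (suc (2 + a) + b) + (suc (2 + a) + b) * (suc (suc (2 + a) + b) + c) + (suc (suc (2 + a) + b) + c) * (2 + a)
    + (1 * c + 3 * b + 1 * b * c + 1 * b * b + 8 * a + 3 * a * c + 7 * a * b + 1 * a * b * c + 1 * a * b * b + 6 * a * a + 1 * a * a * c + 2 * a * a * b + 1 * a * a * a) ≡ (2 + a) * (suc (2 + a) + b) * (suc (suc (2 + a) + b) + c) + 2
  lemma = solve-∀

private
  rotate-≤ : ∀ x {y z} → z * x + x * y + y * z ≤ z * x * y + 2 → x * y + y * z + z * x ≤ x * y * z + 2
  rotate-≤ x {y} {z} = subst₂ _≤_ (lemma x y z) (lemma′ x y z)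
    where
    lemma : ∀ x y z → z * x + x * y + y * z ≡ x * y + y * z + z * x
    lemma = solve-∀
    lemma′ : ∀ x y z → z * x * y + 2 ≡ x * y * z + 2
    lemma′ = solve-∀
  swap-≤ : ∀ x {y z} → x * y + y * z + z * x ≤ x * y * z + 2 → y * x + x * z + z * y ≤ y * x * z + 2
  swap-≤ x {y} {z} = subst₂ _≤_ (lemma x y z) (lemma′ x y z)
    where
    lemma : ∀ x y z → x * y + y * z + z * x ≡ y * x + x * z + z * y
    lemma = solve-∀
    lemma′ : ∀ x y z → x * y * z + 2 ≡ y * x * z + 2
    lemma′ = solve-∀

-- The inequality is symmetric, so every ordering reduces to the increasing one.
distinct-products : ∀ {x y z} → 2 ≤ x → 2 ≤ y → 2 ≤ z → x ≢ y → y ≢ z → z ≢ x →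
  x * y + y * z + z * x ≤ x * y * z + 2
distinct-products {x} {y} {z} 2≤x 2≤y 2≤z x≢y y≢z z≢x
  with ≢⇒<⊎> x≢y | ≢⇒<⊎> y≢z | ≢⇒<⊎> z≢x
  where
  ≢⇒<⊎> : ∀ {m n} → m ≢ n → m < n ⊎ n < m
  ≢⇒<⊎> {m} {n} m≢n with <-cmp m n
  ... | tri< m<n _ _ = inj₁ m<n
  ... | tri≈ _ m≡n _ = contradiction m≡n m≢n
  ... | tri> _ _ n<m = inj₂ n<m
... | inj₁ x<y | inj₁ y<z | _        = increasing-products 2≤x x<y y<z
... | inj₂ y<x | inj₂ z<y | _        = rotate-≤ x (rotate-≤ z (swap-≤ z (increasing-products 2≤z z<y y<x)))
... | inj₁ x<y | inj₂ z<y | inj₁ z<x = rotate-≤ x (increasing-products 2≤z z<x x<y)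
... | inj₁ x<y | inj₂ z<y | inj₂ x<z = rotate-≤ x (swap-≤ x (increasing-products 2≤x x<z z<y))
... | inj₂ y<x | inj₁ y<z | inj₁ z<x = rotate-≤ x (rotate-≤ z (increasing-products 2≤y y<z z<x))
... | inj₂ y<x | inj₁ y<z | inj₂ x<z = swap-≤ y (increasing-products 2≤y y<x x<z)

-- Write x = gcd φ₁ M, and y, z alike. These are pairwise coprime divisors of M, and G = M / (x y)
-- divides both b₁ and b₂, so that φ₃ < x y. With the other two bounds, x y z + 3 ≤ M + 3 ≤ x y + y z + z x.
no-coprime-triangle : ∀ {φ₁ φ₂ φ₃ b₁ b₂ b₃} → 1 ≤ φ₁ → 1 ≤ φ₂ → 1 ≤ φ₃ → let M = φ₁ + φ₂ + φ₃ in
  (∀ {d} → d ∣ φ₁ → d ∣ φ₂ → d ∣ φ₃ → d ≡ 1) →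
  M ∣ b₁ * φ₁ → M ∣ b₂ * φ₂ → M ∣ b₃ * φ₃ →
  (∀ g → g ∣ b₁ → g ∣ b₂ → g * φ₃ < M) →
  (∀ g → g ∣ b₂ → g ∣ b₃ → g * φ₁ < M) →
  (∀ g → g ∣ b₃ → g ∣ b₁ → g * φ₂ < M) → ⊥
no-coprime-triangle {φ₁} {φ₂} {φ₃} {b₁} {b₂} {b₃} 1≤φ₁ 1≤φ₂ 1≤φ₃ coprime M∣₁ M∣₂ M∣₃ h₃ h₁ h₂ =
  <-irrefl refl (begin-strict
    x * y * z + 2                  <⟨ +-monoʳ-< (x * y * z) (s≤s (s≤s (s≤s z≤n))) ⟩
    x * y * z + 3                  ≤⟨ +-monoˡ-≤ 3 (∣⇒≤ {{M≢0}} xyz∣M) ⟩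
    φ₁ + φ₂ + φ₃ + 3               ≡⟨ lemma φ₁ φ₂ φ₃ ⟩
    suc φ₃ + suc φ₁ + suc φ₂       ≤⟨ +-mono-≤ (+-mono-≤ φ₃<xy φ₁<yz) φ₂<zx ⟩
    x * y + y * z + z * x          ≤⟨ distinct-products 2≤x 2≤y 2≤z (distinct 2≤x cop-xy) (distinct 2≤y cop-yz) (distinct 2≤z cop-zx) ⟩
    x * y * z + 2                  ∎)
  where
  open ≤-Reasoning
  M = φ₁ + φ₂ + φ₃
  M≢0 : NonZero M
  M≢0 = >-nonZero (≤-trans 1≤φ₃ (m≤n+m φ₃ (φ₁ + φ₂)))
  x = gcd φ₁ M
  y = gcd φ₂ M
  z = gcd φ₃ M
  lemma : ∀ a b c → a + b + c + 3 ≡ suc c + suc a + suc b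
  lemma = solve-∀

  cop-xy : Coprime x y
  cop-xy (d∣x , d∣y) = coprime d∣₁ d∣₂ (∣m+n∣m⇒∣n (∣-trans d∣x (gcd[m,n]∣n φ₁ M)) (∣m∣n⇒∣m+n d∣₁ d∣₂))
    where
    d∣₁ = ∣-trans d∣x (gcd[m,n]∣m φ₁ M)
    d∣₂ = ∣-trans d∣y (gcd[m,n]∣m φ₂ M)
  cop-zx : Coprime z x
  cop-zx {d} (d∣z , d∣x) = coprime d∣₁ (∣m+n∣m⇒∣n (subst (d ∣_) (rearrange φ₁ φ₂ φ₃) (∣-trans d∣x (gcd[m,n]∣n φ₁ M))) (∣m∣n⇒∣m+n d∣₁ d∣₃)) d∣₃
    where
    d∣₁ = ∣-trans d∣x (gcd[m,n]∣m φ₁ M)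
    d∣₃ = ∣-trans d∣z (gcd[m,n]∣m φ₃ M)
    rearrange : ∀ a b c → a + b + c ≡ a + c + b
    rearrange = solve-∀
  cop-yz : Coprime y z
  cop-yz {d} (d∣y , d∣z) = coprime (∣m+n∣m⇒∣n (subst (d ∣_) (rearrange φ₁ φ₂ φ₃) (∣-trans d∣y (gcd[m,n]∣n φ₂ M))) (∣m∣n⇒∣m+n d∣₂ d∣₃)) d∣₂ d∣₃
    where
    d∣₂ = ∣-trans d∣y (gcd[m,n]∣m φ₂ M)
    d∣₃ = ∣-trans d∣z (gcd[m,n]∣m φ₃ M)
    rearrange : ∀ a b c → a + b + c ≡ b + c + a
    rearrange = solve-∀

  xyz∣M : x * y * z ∣ M
  xyz∣M = coprime-∣-* (coprime-sym (coprime-* cop-zx (coprime-sym cop-yz)))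
    (coprime-∣-* cop-xy (gcd[m,n]∣n φ₁ M) (gcd[m,n]∣n φ₂ M)) (gcd[m,n]∣n φ₃ M)

  -- In M = G · gcd φ M · gcd φ′ M the cofactor G divides both b and b′, so the hypothesis on common
  -- divisors gives G ψ < M, and G cancels.
  bound : ∀ {φ φ′ ψ b b′} → Coprime (gcd φ M) (gcd φ′ M) → M ∣ b * φ → M ∣ b′ * φ′ →
    (∀ g → g ∣ b → g ∣ b′ → g * ψ < M) → ψ < gcd φ M * gcd φ′ M
  bound {φ} {φ′} {ψ} cop M∣bφ M∣b′φ′ h with coprime-∣-* cop (gcd[m,n]∣n φ M) (gcd[m,n]∣n φ′ M)
  ... | divides G eq = *-cancelˡ-< G ψ _ (subst (G * ψ <_) eq (h G
      (cofactor∣ {φ} {u = gcd φ′ M} M∣bφ (trans eq (trans (cong (G *_) (*-comm (gcd φ M) _)) (sym (*-assoc G (gcd φ′ M) (gcd φ M))))))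
      (cofactor∣ {φ′} {u = gcd φ M} M∣b′φ′ (trans eq (sym (*-assoc G (gcd φ M) (gcd φ′ M)))))))
    where
    -- Dividing M ∣ b φ by gcd φ M leaves G u ∣ b c with c = φ / gcd φ M; G u and c are coprime, so
    -- G u divides b.
    cofactor∣ : ∀ {φ G u b} → M ∣ b * φ → M ≡ G * u * gcd φ M → G ∣ b
    cofactor∣ {φ} {G} {u} {b} M∣bφ M≡ with gcd[m,n]∣m φ M
    ... | divides c φ≡ = ∣-trans (m∣m*n u) (coprime-divisor cop-Guc
        (subst (G * u ∣_) (*-comm b c) (*-cancelʳ-∣ (gcd φ M) {{g≢0}} (subst₂ _∣_ M≡ (trans (cong (b *_) φ≡) (sym (*-assoc b c (gcd φ M)))) M∣bφ))))
      where
      g≢0 : NonZero (gcd φ M)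
      g≢0 = m*n≢0⇒n≢0 (G * u) {{subst NonZero M≡ M≢0}}
      cop-Guc : Coprime (G * u) c
      cop-Guc {d} (d∣Gu , d∣c) = ∣1⇒≡1 (*-cancelʳ-∣ (gcd φ M) {{g≢0}} (subst (d * gcd φ M ∣_) (sym (*-identityˡ _))
        (gcd-greatest (subst (d * gcd φ M ∣_) (sym φ≡) (*-monoˡ-∣ (gcd φ M) d∣c))
                      (subst (d * gcd φ M ∣_) (sym M≡) (*-monoˡ-∣ (gcd φ M) d∣Gu)))))

  φ₃<xy : φ₃ < x * y
  φ₃<xy = bound cop-xy M∣₁ M∣₂ h₃
  φ₁<yz : φ₁ < y * z
  φ₁<yz = bound cop-yz M∣₂ M∣₃ h₁
  φ₂<zx : φ₂ < z * x
  φ₂<zx = bound cop-zx M∣₃ M∣₁ h₂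

  gcd≤ : ∀ {φ} → 1 ≤ φ → gcd φ M ≤ φ
  gcd≤ {φ} 1≤φ = ∣⇒≤ {{>-nonZero 1≤φ}} (gcd[m,n]∣m φ M)
  -- For w = 1 the bounds would read u < v < u. They apply to x, y, z because each gcd is at most
  -- its φ.
  ≥2 : ∀ {u v w} → u < v * w → v < w * u → 2 ≤ w
  ≥2 {u} {v} {zero}        u<vw v<wu = contradiction v<wu λ ()
  ≥2 {u} {v} {suc zero}    u<vw v<wu = contradiction (<-trans (subst (u <_) (*-identityʳ v) u<vw) (subst (v <_) (*-identityˡ u) v<wu)) (<-irrefl refl)
  ≥2 {u} {v} {suc (suc _)} _ _ = s≤s (s≤s z≤n)
  x<yz : x < y * z
  x<yz = ≤-<-trans (gcd≤ 1≤φ₁) φ₁<yz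
  y<zx : y < z * x
  y<zx = ≤-<-trans (gcd≤ 1≤φ₂) φ₂<zx
  z<xy : z < x * y
  z<xy = ≤-<-trans (gcd≤ 1≤φ₃) φ₃<xy
  2≤x : 2 ≤ x
  2≤x = ≥2 y<zx z<xy
  2≤y : 2 ≤ y
  2≤y = ≥2 z<xy x<yz
  2≤z : 2 ≤ z
  2≤z = ≥2 x<yz y<zx
  distinct : ∀ {u v} → 2 ≤ u → Coprime u v → u ≢ v
  distinct 2≤u cop refl = <⇒≢ 2≤u (sym (cop (∣-refl , ∣-refl)))

-- The divisibilities and strict bounds are homogeneous in F₁, F₂, F₃, so the greatest common
-- divisor h can be divided out, which leaves the coprime case.
no-triangle : ∀ {F₁ F₂ F₃ b₁ b₂ b₃} → 1 ≤ F₁ → 1 ≤ F₂ → 1 ≤ F₃ → let N = F₁ + F₂ + F₃ in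
  N ∣ b₁ * F₁ → N ∣ b₂ * F₂ → N ∣ b₃ * F₃ →
  (∀ g → g ∣ b₁ → g ∣ b₂ → g * F₃ < N) →
  (∀ g → g ∣ b₂ → g ∣ b₃ → g * F₁ < N) →
  (∀ g → g ∣ b₃ → g ∣ b₁ → g * F₂ < N) → ⊥
no-triangle {F₁} {F₂} {F₃} {b₁} {b₂} {b₃} 1≤F₁ 1≤F₂ 1≤F₃ N∣₁ N∣₂ N∣₃ h₃ h₁ h₂
  with gcd F₁ (gcd F₂ F₃) in eq | gcd[m,n]∣m F₁ (gcd F₂ F₃) | gcd[m,n]∣n F₁ (gcd F₂ F₃)
... | h | divides φ₁ refl | h∣₂₃
  with ∣-trans h∣₂₃ (gcd[m,n]∣m F₂ F₃) | ∣-trans h∣₂₃ (gcd[m,n]∣n F₂ F₃)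
... | divides φ₂ refl | divides φ₃ refl =
  no-coprime-triangle (positive φ₁ 1≤F₁) (positive φ₂ 1≤F₂) (positive φ₃ 1≤F₃)
    coprime (reduce b₁ φ₁ N∣₁) (reduce b₂ φ₂ N∣₂) (reduce b₃ φ₃ N∣₃)
    (λ g p q → lower g φ₃ (h₃ g p q)) (λ g p q → lower g φ₁ (h₁ g p q)) (λ g p q → lower g φ₂ (h₂ g p q))
  where
  M = φ₁ + φ₂ + φ₃
  N≡ : φ₁ * h + φ₂ * h + φ₃ * h ≡ M * h
  N≡ = lemma φ₁ φ₂ φ₃ h
    where
    lemma : ∀ a b c h → a * h + b * h + c * h ≡ (a + b + c) * h
    lemma = solve-∀
  h≢0 : NonZero h
  h≢0 = m*n≢0⇒n≢0 φ₁ {{>-nonZero 1≤F₁}}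
  positive : ∀ φ → 1 ≤ φ * h → 1 ≤ φ
  positive (suc _) _ = s≤s z≤n
  reduce : ∀ b φ → φ₁ * h + φ₂ * h + φ₃ * h ∣ b * (φ * h) → M ∣ b * φ
  reduce b φ N∣ = *-cancelʳ-∣ h {{h≢0}} (subst₂ _∣_ N≡ (sym (*-assoc b φ h)) N∣)
  lower : ∀ g φ → g * (φ * h) < φ₁ * h + φ₂ * h + φ₃ * h → g * φ < M
  lower g φ lt = *-cancelʳ-< h (g * φ) M (subst₂ _<_ (sym (*-assoc g φ h)) N≡ lt)
  coprime : ∀ {d} → d ∣ φ₁ → d ∣ φ₂ → d ∣ φ₃ → d ≡ 1
  coprime {d} d∣₁ d∣₂ d∣₃ = ∣1⇒≡1 (*-cancelʳ-∣ h {{h≢0}} (subst (d * h ∣_) (trans eq (sym (*-identityˡ h)))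
    (gcd-greatest (*-monoˡ-∣ h d∣₁) (gcd-greatest (*-monoˡ-∣ h d∣₂) (*-monoˡ-∣ h d∣₃)))))

-- The lower bound over a common denominator

-- Terms are deleted by setting them to 0, so that the index set stays `Fin k`.
sum-updateAt-0 : ∀ (f : Fin k → ℕ) i → sum f ≡ f i + sum (updateAt f i (const 0))
sum-updateAt-0 f zero    = refl
sum-updateAt-0 f (suc i) = begin
  f zero + sum (f ∘ suc)          ≡⟨ cong (λ z → f zero + z) (sum-updateAt-0 (f ∘ suc) i) ⟩
  f zero + (f (suc i) + rest)     ≡⟨ lemma (f zero) (f (suc i)) rest ⟩
  f (suc i) + (f zero + rest)     ∎
  where
  open ≡-Reasoning
  rest = sum (updateAt (f ∘ suc) i (const 0))
  lemma : ∀ a b c → a + (b + c) ≡ b + (a + c)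
  lemma = solve-∀

sum-const : ∀ k c → sum {k} (const c) ≡ k * c
sum-const zero    c = refl
sum-const (suc k) c = cong (λ z → c + z) (sum-const k c)

∣-sum : ∀ {d} (f : Fin k → ℕ) → (∀ i → d ∣ f i) → d ∣ sum f
∣-sum {zero}  f d∣f = _ ∣0
∣-sum {suc k} f d∣f = ∣m∣n⇒∣m+n (d∣f zero) (∣-sum (f ∘ suc) (d∣f ∘ suc))

unit : Fin k → ℕ → Fin k → ℕ
unit i c = updateAt (const 0) i (const c)

sum-unit : ∀ (w : Fin k → ℕ) i c → sum (λ l → unit i c l * w l) ≡ c * w i
sum-unit {suc k} w zero    c = trans (cong (λ z → c * w zero + z) (sum-replicate-zero k)) (+-identityʳ _)
sum-unit {suc k} w (suc i) c = sum-unit (w ∘ suc) i c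

unit-≤ : ∀ (a : Fin k → ℕ) i {c} → c ≤ a i → ∀ l → unit i c l ≤ a l
unit-≤ a i {c} c≤ l with l ≟F i
... | yes refl = ≤-trans (≤-reflexive (updateAt-updates i _)) c≤
... | no  l≢i  = ≤-trans (≤-reflexive (updateAt-minimal l i _ l≢i)) z≤n

unit+unit-≤ : ∀ (a : Fin k → ℕ) {i j c d} → i ≢ j → c ≤ a i → d ≤ a j → ∀ l → unit i c l + unit j d l ≤ a l
unit+unit-≤ a {i} {j} {c} {d} i≢j c≤ d≤ l with l ≟F i
... | yes refl = ≤-trans (≤-reflexive (trans (cong (λ z → unit i c i + z) (updateAt-minimal i j _ i≢j)) (+-identityʳ _))) (unit-≤ a i c≤ i)
... | no  l≢i  = ≤-trans (≤-reflexive (cong (_+ unit j d l) (updateAt-minimal l i _ l≢i))) (unit-≤ a j d≤ l)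

argmin : 1 ≤ k → (f : Fin k → ℕ) → ∃ λ i → ∀ j → f i ≤ f j
argmin {suc zero}    _ f = zero , λ { zero → ≤-refl }
argmin {suc (suc k)} _ f with argmin (s≤s z≤n) (f ∘ suc)
... | i , min with ≤-total (f zero) (f (suc i))
... | inj₁ le = zero , λ { zero → ≤-refl ; (suc j) → ≤-trans le (min j) }
... | inj₂ ge = suc i , λ { zero → ge ; (suc j) → min j }

∃≢ : 2 ≤ k → (i : Fin k) → ∃ λ j → j ≢ i
∃≢ (s≤s (s≤s _)) zero    = suc zero , λ ()
∃≢ (s≤s (s≤s _)) (suc _) = zero , λ ()

-- The product of the values. A general P covers both being nonzero and being coprime to a fixed
-- number.
common-multiple : (P : ℕ → Set) → P 1 → (∀ {m n} → P m → P n → P (m * n)) →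
  (f : Fin k → ℕ) → (∀ i → P (f i)) → ∃ λ R → P R × (∀ i → f i ∣ R)
common-multiple {zero}  P P1 P* f Pf = 1 , P1 , λ ()
common-multiple {suc k} P P1 P* f Pf =
  let R , PR , f∣R = common-multiple P P1 P* (f ∘ suc) (Pf ∘ suc) in
  f zero * R , P* (Pf zero) PR ,
  λ { zero → m∣m*n R ; (suc i) → ∣n⇒∣m*n (f zero) (f∣R i) }

coprime-multiple : ∀ x (f : Fin k → ℕ) → (∀ i → Coprime x (f i)) → ∃ λ R → Coprime x R × (∀ i → f i ∣ R)
coprime-multiple x = common-multiple (Coprime x) (coprime-sym (1-coprimeTo x)) coprime-*

-- The terms are brought to a common denominator N, so that w i = N / b i and W = N / n; then
-- A i / N and F i / N are a i / b i and 1 - a i / b i.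
module _ {k : ℕ} (a b w : Fin k → ℕ) {m n N W : ℕ}
  (1≤N : 1 ≤ N) (N≡n*W : N ≡ n * W) (w*b≡N : ∀ i → w i * b i ≡ N)
  (m⊥n : Coprime m n)
  (∑aw≡mW : sum (λ i → a i * w i) ≡ m * W)
  (2N≤mW : 2 * N ≤ m * W)
  (kN≤ : k * N ≤ N + m * W)
  (faithful : ∀ (x : Fin k → ℕ) → (∀ i → x i ≤ a i) → ∀ c → sum (λ i → x i * w i) ≡ c * W →
              sum (λ i → x i * w i) ≡ m * W ⊎ sum (λ i → x i * w i) ≡ 0)
  where

  private
    instance
      N≢0 : NonZero N
      N≢0 = >-nonZero 1≤N
      W≢0 : NonZero W
      W≢0 = m*n≢0⇒n≢0 n {{subst NonZero N≡n*W N≢0}}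
      n≢0 : NonZero n
      n≢0 = m*n≢0⇒m≢0 n {{subst NonZero N≡n*W N≢0}}
      w≢0 : ∀ {i} → NonZero (w i)
      w≢0 {i} = m*n≢0⇒m≢0 (w i) {{subst NonZero (sym (w*b≡N i)) N≢0}}
      b≢0 : ∀ {i} → NonZero (b i)
      b≢0 {i} = m*n≢0⇒n≢0 (w i) {{subst NonZero (sym (w*b≡N i)) N≢0}}

    -- Such a subsum has value c / n in (0, 1], whereas faithfulness allows only 0 and m / n ≥ 2.
    no-subsum : ∀ (x : Fin k → ℕ) → (∀ i → x i ≤ a i) → ∀ c → sum (λ i → x i * w i) ≡ c * W →
                1 ≤ c * W → c * W ≤ N → ⊥
    no-subsum x x≤a c eq 1≤cW cW≤N with faithful x x≤a c eq
    ... | inj₁ ≡mW = <-irrefl refl (begin-strict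
      N        <⟨ m<m+n N 1≤N ⟩
      N + N    ≡⟨ cong (λ z → N + z) (sym (+-identityʳ N)) ⟩
      2 * N    ≤⟨ 2N≤mW ⟩
      m * W    ≡⟨ trans (sym ≡mW) eq ⟩
      c * W    ≤⟨ cW≤N ⟩
      N        ∎)
      where open ≤-Reasoning
    ... | inj₂ ≡0  = <⇒≢ 1≤cW (trans (sym ≡0) eq)

    no-single : ∀ i x → x ≤ a i → ∀ c → x * w i ≡ c * W → 1 ≤ c * W → c * W ≤ N → ⊥
    no-single i x x≤a c eq = no-subsum (unit i x) (unit-≤ a i x≤a) c (trans (sum-unit w i x) eq)

    no-pair : ∀ {i j} → i ≢ j → ∀ x y → x ≤ a i → y ≤ a j → x * w i + y * w j ≡ N → ⊥
    no-pair {i} {j} i≢j x y x≤a y≤a eq = no-subsum (λ l → unit i x l + unit j y l) (unit+unit-≤ a i≢j x≤a y≤a) n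
      (begin
        sum (λ l → (unit i x l + unit j y l) * w l)                        ≡⟨ sum-cong-≗ (λ l → *-distribʳ-+ (w l) (unit i x l) (unit j y l)) ⟩
        sum (λ l → unit i x l * w l + unit j y l * w l)                    ≡⟨ ∑-distrib-+ (λ l → unit i x l * w l) (λ l → unit j y l * w l) ⟩
        sum (λ l → unit i x l * w l) + sum (λ l → unit j y l * w l)        ≡⟨ cong₂ _+_ (sum-unit w i x) (sum-unit w j y) ⟩
        x * w i + y * w j                                                  ≡⟨ trans eq N≡n*W ⟩
        n * W                                                              ∎)
      (subst (1 ≤_) N≡n*W 1≤N) (≤-reflexive (sym N≡n*W))
      where open ≡-Reasoning

    a<b : ∀ i → a i < b i
    a<b i = ≰⇒> λ b≤a → no-single i (b i) b≤a n (trans (*-comm (b i) (w i)) (trans (w*b≡N i) N≡n*W))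
      (subst (1 ≤_) N≡n*W 1≤N) (≤-reflexive (sym N≡n*W))

    A F : Fin k → ℕ
    A i = a i * w i
    F i = (b i ∸ a i) * w i

    F+A≡N : ∀ i → F i + A i ≡ N
    F+A≡N i = begin
      (b i ∸ a i) * w i + a i * w i   ≡⟨ sym (*-distribʳ-+ (w i) (b i ∸ a i) (a i)) ⟩
      (b i ∸ a i + a i) * w i         ≡⟨ cong (_* w i) (m∸n+n≡m (<⇒≤ (a<b i))) ⟩
      b i * w i                       ≡⟨ trans (*-comm (b i) (w i)) (w*b≡N i) ⟩
      N                               ∎
      where open ≡-Reasoning

    1≤F : ∀ i → 1 ≤ F i
    1≤F i = *-mono-≤ (m<n⇒0<n∸m (a<b i)) (>-nonZero⁻¹ (w i))

    A<N : ∀ i → A i < N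
    A<N i = subst (A i <_) (F+A≡N i) (m<n+m (A i) (1≤F i))

    ∑F+mW≡kN : sum F + m * W ≡ k * N
    ∑F+mW≡kN = begin
      sum F + m * W                 ≡⟨ cong (λ z → sum F + z) (sym ∑aw≡mW) ⟩
      sum F + sum A                 ≡⟨ sym (∑-distrib-+ F A) ⟩
      sum (λ i → F i + A i)         ≡⟨ sum-cong-≗ F+A≡N ⟩
      sum {k} (const N)             ≡⟨ sum-const k N ⟩
      k * N                         ∎
      where open ≡-Reasoning

    -- The deficits sum to k - m / n, and `kN≤` says that k ≤ 1 + m / n.
    ∑F≤N : sum F ≤ N
    ∑F≤N = +-cancelʳ-≤ (m * W) (sum F) N (subst (_≤ N + m * W) (sym ∑F+mW≡kN) kN≤)

    pair-rest : ∀ {i j} → i ≢ j → sum F ≡ F i + (F j + sum (updateAt (updateAt F i (const 0)) j (const 0)))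
    pair-rest {i} {j} i≢j = trans (sum-updateAt-0 F i) (cong (λ z → F i + z)
      (trans (sum-updateAt-0 (updateAt F i (const 0)) j)
        (cong (_+ sum (updateAt (updateAt F i (const 0)) j (const 0))) (updateAt-minimal j i F (≢-sym i≢j)))))

    F+F≤N : ∀ {i j} → i ≢ j → F i + F j ≤ N
    F+F≤N {i} {j} i≢j = ≤-trans (+-monoʳ-≤ (F i) (m≤m+n (F j) _)) (≤-trans (≤-reflexive (sym (pair-rest i≢j))) ∑F≤N)

    -- If b i divides a i b j, it divides (b i - a i) b j too, so the deficit of i equals y / b j
    -- for some y. As the deficits of i and j sum to at most 1, y ≤ a j, and a i / b i + y / b j = 1
    -- is a forbidden subsum.
    ¬b∣ab : ∀ {i j} → i ≢ j → ¬ (b i ∣ a i * b j)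
    ¬b∣ab {i} {j} i≢j b∣ab with ∣m+n∣m⇒∣n {n = (b i ∸ a i) * b j} (subst (b i ∣_) eq (m∣m*n (b j))) b∣ab
      where
      eq : b i * b j ≡ a i * b j + (b i ∸ a i) * b j
      eq = trans (cong (_* b j) (sym (m+[n∸m]≡n (<⇒≤ (a<b i))))) (*-distribʳ-+ (b j) (a i) _)
    ... | divides y db≡yb = no-pair i≢j (a i) y ≤-refl
        (*-cancelʳ-≤ y (a j) (w j) (subst (_≤ A j) (sym yw≡F) (+-cancelʳ-≤ (F j) (F i) (A j)
          (≤-trans (F+F≤N i≢j) (≤-reflexive (trans (sym (F+A≡N j)) (+-comm (F j) (A j))))))))
        (trans (cong (λ z → A i + z) yw≡F) (trans (+-comm (A i) (F i)) (F+A≡N i)))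
      where
      d = b i ∸ a i
      lemma : ∀ x y z → x * y * z ≡ x * z * y
      lemma = solve-∀
      yw≡F : y * w j ≡ F i
      yw≡F = *-cancelʳ-≡ (y * w j) (F i) (b i) (begin
        y * w j * b i      ≡⟨ lemma y (w j) (b i) ⟩
        y * b i * w j      ≡⟨ cong (_* w j) (sym db≡yb) ⟩
        d * b j * w j      ≡⟨ trans (*-assoc d (b j) (w j)) (cong (d *_) (*-comm (b j) (w j))) ⟩
        d * (w j * b j)    ≡⟨ cong (d *_) (trans (w*b≡N j) (sym (w*b≡N i))) ⟩
        d * (w i * b i)    ≡⟨ sym (*-assoc d (w i) (b i)) ⟩
        d * w i * b i      ∎)
        where open ≡-Reasoning

    -- With a deficit of at most 1/2, 1 / g ≤ 1/2 ≤ a i / b i. As 1 / g is a multiple of both 1 / b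
    -- i and 1 / n, it would be a forbidden subsum.
    common-with-n : ∀ {i g} → 2 ≤ g → g ∣ b i → g ∣ n → N < 2 * F i
    common-with-n {i} {g} 2≤g (divides q b≡qg) (divides c n≡cg) = ≰⇒> λ 2F≤N →
      no-single i q (*-cancelʳ-≤ q (a i) (w i) (qw≤A 2F≤N)) c qw≡cW (subst (1 ≤_) qw≡cW 1≤qw) (subst (_≤ N) qw≡cW qw≤N)
      where
      lemma : ∀ x y z → x * y * z ≡ x * z * y
      lemma = solve-∀
      instance
        g≢0 : NonZero g
        g≢0 = >-nonZero (<⇒≤ 2≤g)
        q≢0 : NonZero q
        q≢0 = m*n≢0⇒m≢0 q {{subst NonZero b≡qg b≢0}}
      qwg≡N : q * w i * g ≡ N
      qwg≡N = trans (lemma q (w i) g) (trans (cong (_* w i) (sym b≡qg)) (trans (*-comm (b i) (w i)) (w*b≡N i)))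
      qw≡cW : q * w i ≡ c * W
      qw≡cW = *-cancelʳ-≡ (q * w i) (c * W) g (trans qwg≡N (trans N≡n*W (trans (cong (_* W) n≡cg) (lemma c g W))))
      1≤qw : 1 ≤ q * w i
      1≤qw = *-mono-≤ (>-nonZero⁻¹ q) (>-nonZero⁻¹ (w i))
      qw≤N : q * w i ≤ N
      qw≤N = subst (q * w i ≤_) qwg≡N (m≤m*n (q * w i) g)
      qw≤A : 2 * F i ≤ N → q * w i ≤ A i
      qw≤A 2F≤N = *-cancelˡ-≤ 2 (+-cancelˡ-≤ (2 * F i) _ _ (begin
        2 * F i + 2 * (q * w i)  ≤⟨ +-mono-≤ 2F≤N (subst (2 * (q * w i) ≤_) (trans (*-comm g (q * w i)) qwg≡N) (*-monoˡ-≤ (q * w i) 2≤g)) ⟩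
        N + N                    ≡⟨ cong₂ _+_ (sym (F+A≡N i)) (sym (F+A≡N i)) ⟩
        F i + A i + (F i + A i)  ≡⟨ lemma₂ (F i) (A i) ⟩
        2 * F i + 2 * A i        ∎))
        where
        open ≤-Reasoning
        lemma₂ : ∀ x y → x + y + (x + y) ≡ 2 * x + 2 * y
        lemma₂ = solve-∀

    -- Otherwise a multiple r / g of 1 / g would lie between F j / N and A i / N, and r / g + (g - r) / g = 1.
    common-factor : ∀ {i j g} → i ≢ j → g ∣ b i → g ∣ b j → g * N < N + g * (F i + F j)
    common-factor {i} {j} {g} i≢j (divides q b≡qg) (divides q′ b≡q′g) = ≰⇒> λ N+gFF≤gN →
      no-pair i≢j (q * r) (q′ * s)
        (*-cancelʳ-≤ (q * r) (a i) (w i) (*-cancelʳ-≤ _ _ g (≤-trans (≤-reflexive (scale i q b≡qg r)) rN≤Ag)))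
        (*-cancelʳ-≤ (q′ * s) (a j) (w j) (*-cancelʳ-≤ _ _ g (≤-trans (≤-reflexive (scale j q′ b≡q′g s)) (sN≤Ag N+gFF≤gN))))
        (*-cancelʳ-≡ _ N g (begin-equality
          (q * r * w i + q′ * s * w j) * g        ≡⟨ *-distribʳ-+ g (q * r * w i) _ ⟩
          q * r * w i * g + q′ * s * w j * g      ≡⟨ cong₂ _+_ (scale i q b≡qg r) (scale j q′ b≡q′g s) ⟩
          r * N + s * N                           ≡⟨ rN+sN≡gN ⟩
          g * N                                   ≡⟨ *-comm g N ⟩
          N * g                                   ∎))
      where
      open ≤-Reasoning
      instance
        g≢0 : NonZero g
        g≢0 = m*n≢0⇒n≢0 q {{subst NonZero b≡qg b≢0}}
      -- The largest r with r / g ≤ a i / b i. Since r / g > a i / b i - 1 / g, the assumption on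
      -- the deficits gives r / g > F j / N, that is, (g - r) / g < a j / b j.
      r = A i * g / N
      s = g ∸ r
      scale : ∀ l q → b l ≡ q * g → ∀ r → q * r * w l * g ≡ r * N
      scale l q b≡qg r = trans (lemma q r (w l) g) (trans (cong (λ z → r * (w l * z)) (sym b≡qg)) (cong (r *_) (w*b≡N l)))
        where
        lemma : ∀ q r w g → q * r * w * g ≡ r * (w * (q * g))
        lemma = solve-∀
      Ag≡ : A i * g ≡ A i * g % N + r * N
      Ag≡ = m≡m%n+[m/n]*n (A i * g) N
      rN≤Ag : r * N ≤ A i * g
      rN≤Ag = ≤-trans (m≤n+m (r * N) _) (≤-reflexive (sym Ag≡))
      r≤g : r ≤ g
      r≤g = *-cancelʳ-≤ r g N (≤-trans rN≤Ag (≤-trans (*-monoˡ-≤ g (<⇒≤ (A<N i))) (≤-reflexive (*-comm N g))))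
      rN+sN≡gN : r * N + s * N ≡ g * N
      rN+sN≡gN = trans (sym (*-distribʳ-+ N r s)) (cong (_* N) (m+[n∸m]≡n r≤g))
      gN≡ : ∀ l → g * N ≡ g * F l + A l * g
      gN≡ l = trans (cong (g *_) (sym (F+A≡N l))) (trans (*-distribˡ-+ g (F l) (A l)) (cong (λ z → g * F l + z) (*-comm g (A l))))
      gF<rN : N + g * (F i + F j) ≤ g * N → g * F j < r * N
      gF<rN le = +-cancelˡ-< (N + g * F i) _ _ (begin-strict
        N + g * F i + g * F j               ≡⟨ lemma N g (F i) (F j) ⟩
        N + g * (F i + F j)                 ≤⟨ le ⟩
        g * N                               ≡⟨ gN≡ i ⟩
        g * F i + A i * g                   ≡⟨ cong (λ z → g * F i + z) Ag≡ ⟩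
        g * F i + (A i * g % N + r * N)     <⟨ +-monoʳ-< (g * F i) (+-monoˡ-< (r * N) (m%n<n (A i * g) N)) ⟩
        g * F i + (N + r * N)               ≡⟨ lemma′ (g * F i) N (r * N) ⟩
        N + g * F i + r * N                 ∎)
        where
        lemma : ∀ N g x y → N + g * x + g * y ≡ N + g * (x + y)
        lemma = solve-∀
        lemma′ : ∀ x y z → x + (y + z) ≡ y + x + z
        lemma′ = solve-∀
      sN≤Ag : N + g * (F i + F j) ≤ g * N → s * N ≤ A j * g
      sN≤Ag le = +-cancelˡ-≤ (r * N) _ _ (begin
        r * N + s * N          ≡⟨ trans rN+sN≡gN (gN≡ j) ⟩
        g * F j + A j * g      ≤⟨ +-monoˡ-≤ (A j * g) (<⇒≤ (gF<rN le)) ⟩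
        r * N + A j * g        ∎)

    -- By `common-factor` the two deficits sum to more than 1 - 1 / g ≥ 1/2.
    ¬coprime⇒heavy : ∀ {i j} → i ≢ j → ¬ Coprime (b i) (b j) → N < 2 * (F i + F j)
    ¬coprime⇒heavy {i} {j} i≢j ¬cop with ¬coprime⇒common-factor (>-nonZero⁻¹ (b i)) ¬cop
    ... | g , 2≤g , g∣bi , g∣bj = ≰⇒> λ 2S≤N → <-irrefl refl (begin-strict
      2 * (g * N)                        <⟨ *-monoʳ-< 2 (common-factor i≢j g∣bi g∣bj) ⟩
      2 * (N + g * (F i + F j))          ≡⟨ lemma N g (F i + F j) ⟩
      2 * N + g * (2 * (F i + F j))      ≤⟨ +-mono-≤ (*-monoˡ-≤ N 2≤g) (*-monoʳ-≤ g 2S≤N) ⟩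
      g * N + g * N                      ≡⟨ cong (λ z → g * N + z) (sym (+-identityʳ (g * N))) ⟩
      2 * (g * N)                        ∎)
      where
      open ≤-Reasoning
      lemma : ∀ N g s → 2 * (N + g * s) ≡ 2 * N + g * (2 * s)
      lemma = solve-∀

    light⇒coprime-n : ∀ {i} → 2 * F i ≤ N → Coprime (b i) n
    light⇒coprime-n {i} 2F≤N = decidable-stable (coprime? (b i) n) λ ¬cop →
      let g , 2≤g , g∣b , g∣n = ¬coprime⇒common-factor (>-nonZero⁻¹ (b i)) ¬cop
      in <⇒≱ (common-with-n 2≤g g∣b g∣n) 2F≤N

    N∣wR : ∀ {l R} → b l ∣ R → N ∣ A l * R
    N∣wR {l} {R} b∣R = ∣-trans (∣-reflexive (sym (w*b≡N l)))
      (subst (w l * b l ∣_) (sym (*-assoc (a l) (w l) R)) (∣n⇒∣m*n (a l) (*-monoʳ-∣ (w l) b∣R)))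

    -- Multiply by R the equation expressing a i / b i as m / n minus the other terms: the right
    -- side becomes an integer.
    b∣aR : ∀ i R → n ∣ R → (∀ l → l ≢ i → b l ∣ R) → b i ∣ a i * R
    b∣aR i R n∣R b∣R = *-cancelˡ-∣ (w i) (subst₂ _∣_ (sym (w*b≡N i)) (lemma (a i) (w i) R)
      (∣m+n∣m⇒∣n (subst (N ∣_) split N∣mWR) N∣rest))
      where
      lemma : ∀ a w R → a * w * R ≡ w * (a * R)
      lemma = solve-∀
      rest = updateAt A i (const 0)
      N∣rest : N ∣ sum rest * R
      N∣rest = subst (N ∣_) (sym (*-distribʳ-sum R rest)) (∣-sum _ λ l → N∣restₗ l)
        where
        N∣restₗ : ∀ l → N ∣ rest l * R
        N∣restₗ l with l ≟F i
        ... | yes refl = subst (λ z → N ∣ z * R) (sym (updateAt-updates i A)) (N ∣0)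
        ... | no  l≢i  = subst (λ z → N ∣ z * R) (sym (updateAt-minimal l i A l≢i)) (N∣wR (b∣R l l≢i))
      N∣mWR : N ∣ m * W * R
      N∣mWR = subst₂ _∣_ (sym N≡n*W) (lemma′ m R W) (∣n⇒∣m*n m (*-monoˡ-∣ W n∣R))
        where
        lemma′ : ∀ m R W → m * (R * W) ≡ m * W * R
        lemma′ = solve-∀
      split : m * W * R ≡ sum rest * R + A i * R
      split = trans (cong (_* R) (trans (sym ∑aw≡mW) (trans (sum-updateAt-0 A i) (+-comm (A i) (sum rest)))))
        (*-distribʳ-+ R (sum rest) (A i))

    n∣mR : ∀ R → (∀ l → b l ∣ R) → n ∣ m * R
    n∣mR R b∣R = *-cancelʳ-∣ W (subst₂ _∣_ N≡n*W (trans (cong (_* R) ∑aw≡mW) (lemma m W R))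
      (subst (N ∣_) (sym (*-distribʳ-sum R A)) (∣-sum _ λ l → N∣wR (b∣R l))))
      where
      lemma : ∀ m W R → m * W * R ≡ m * R * W
      lemma = solve-∀

    -- If b i were coprime to every b l with l other than i and j, these b l would have a common
    -- multiple R coprime to b i. Then n R b j clears all denominators but b i, so b i ∣ a i n R b
    -- j; cancelling n and R contradicts `¬b∣ab`.
    neighbour : ∀ i → Coprime (b i) n → ∀ {j} → j ≢ i → ∃ λ l → l ≢ i × l ≢ j × ¬ Coprime (b i) (b l)
    neighbour i cop-n {j} j≢i
      with any? (λ l → ¬? (l ≟F i) ×-dec ¬? (l ≟F j) ×-dec ¬? (coprime? (b i) (b l)))
    ... | yes (l , l≢i , l≢j , ¬cop) = l , l≢i , l≢j , ¬cop
    ... | no ¬any = ⊥-elim (¬b∣ab (≢-sym j≢i) (coprime-divisor cop-R (coprime-divisor cop-n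
        (subst (b i ∣_) (lemma (a i) n R (b j)) (b∣aR i (n * (R * b j)) (m∣m*n (R * b j)) b∣)))))
      where
      f : Fin k → ℕ
      -- The entries at i and j become 1, so that R is built from the other denominators only.
      f = updateAt (updateAt b i (const 1)) j (const 1)
      f≡b : ∀ {l} → l ≢ i → l ≢ j → f l ≡ b l
      f≡b {l} l≢i l≢j = trans (updateAt-minimal l j _ l≢j) (updateAt-minimal l i b l≢i)
      cop-f : ∀ l → Coprime (b i) (f l)
      cop-f l with l ≟F j
      ... | yes refl = subst (Coprime (b i)) (sym (updateAt-updates j _)) (coprime-sym (1-coprimeTo (b i)))
      ... | no l≢j with l ≟F i
      ...   | yes refl = subst (Coprime (b i)) (sym (trans (updateAt-minimal i j _ l≢j) (updateAt-updates i b))) (coprime-sym (1-coprimeTo (b i)))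
      ...   | no l≢i with coprime? (b i) (b l)
      ...     | yes cop = subst (Coprime (b i)) (sym (f≡b l≢i l≢j)) cop
      ...     | no ¬cop = ⊥-elim (¬any (l , l≢i , l≢j , ¬cop))
      multiple = coprime-multiple (b i) f cop-f
      R = proj₁ multiple
      cop-R : Coprime (b i) R
      cop-R = proj₁ (proj₂ multiple)
      f∣R : ∀ l → f l ∣ R
      f∣R = proj₂ (proj₂ multiple)
      lemma : ∀ a n R b → a * (n * (R * b)) ≡ n * (R * (a * b))
      lemma = solve-∀
      b∣ : ∀ l → l ≢ i → b l ∣ n * (R * b j)
      b∣ l l≢i with l ≟F j
      ... | yes refl = ∣n⇒∣m*n n (n∣m*n R)
      ... | no l≢j   = ∣n⇒∣m*n n (∣m⇒∣m*n (b j) (subst (_∣ R) (f≡b l≢i l≢j) (f∣R l)))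

    module Triple {i j l : Fin k} (i-min : ∀ s → F i ≤ F s)
      (j≢i : j ≢ i) (l≢i : l ≢ i) (l≢j : l ≢ j)
      (¬cop-ij : ¬ Coprime (b i) (b j)) (¬cop-il : ¬ Coprime (b i) (b l)) where

      G₁ G₂ G₃ : Fin k → ℕ
      G₁ = updateAt F i (const 0)
      G₂ = updateAt G₁ j (const 0)
      G₃ = updateAt G₂ l (const 0)

      ∑F≡ : sum F ≡ F i + F j + F l + sum G₃
      ∑F≡ = begin
        sum F                                   ≡⟨ pair-rest (≢-sym j≢i) ⟩
        F i + (F j + sum G₂)                    ≡⟨ cong (λ z → F i + (F j + z)) (sum-updateAt-0 G₂ l) ⟩
        F i + (F j + (G₂ l + sum G₃))           ≡⟨ cong (λ z → F i + (F j + (z + sum G₃))) (trans (updateAt-minimal l j G₁ l≢j) (updateAt-minimal l i F l≢i)) ⟩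
        F i + (F j + (F l + sum G₃))            ≡⟨ lemma (F i) (F j) (F l) (sum G₃) ⟩
        F i + F j + F l + sum G₃                ∎
        where
        open ≡-Reasoning
        lemma : ∀ a b c d → a + (b + (c + d)) ≡ a + b + c + d
        lemma = solve-∀

      -- The pairs i, j and i, l each have deficits summing to more than 1/2. Adding the two bounds
      -- counts F i twice, while all deficits together sum to at most 1.
      rest<F : sum G₃ < F i
      rest<F = *-cancelˡ-< 2 _ _ (+-cancelˡ-< (2 * (F i + F j + F l)) _ _ (begin-strict
        2 * (F i + F j + F l) + 2 * sum G₃          ≡⟨ trans (sym (*-distribˡ-+ 2 (F i + F j + F l) (sum G₃))) (cong (2 *_) (sym ∑F≡)) ⟩
        2 * sum F                                   ≤⟨ *-monoʳ-≤ 2 ∑F≤N ⟩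
        2 * N                                       ≡⟨ cong (λ z → N + z) (+-identityʳ N) ⟩
        N + N                                       <⟨ +-mono-< (¬coprime⇒heavy (≢-sym j≢i) ¬cop-ij) (¬coprime⇒heavy (≢-sym l≢i) ¬cop-il) ⟩
        2 * (F i + F j) + 2 * (F i + F l)           ≡⟨ lemma (F i) (F j) (F l) ⟩
        2 * (F i + F j + F l) + 2 * F i             ∎))
        where
        open ≤-Reasoning
        lemma : ∀ a b c → 2 * (a + b) + 2 * (a + c) ≡ 2 * (a + b + c) + 2 * a
        lemma = solve-∀

      -- By minimality a fourth index would have deficit at least F i, more than `rest<F` allows.
      cover : ∀ s → s ≡ i ⊎ s ≡ j ⊎ s ≡ l
      cover s with s ≟F i | s ≟F j | s ≟F l
      ... | yes s≡i | _       | _       = inj₁ s≡i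
      ... | no _    | yes s≡j | _       = inj₂ (inj₁ s≡j)
      ... | no _    | no _    | yes s≡l = inj₂ (inj₂ s≡l)
      ... | no s≢i  | no s≢j  | no s≢l  = contradiction rest<F (≤⇒≯ (begin
        F i                                       ≤⟨ i-min s ⟩
        F s                                       ≡⟨ sym (trans (updateAt-minimal s l G₂ s≢l) (trans (updateAt-minimal s j G₁ s≢j) (updateAt-minimal s i F s≢i))) ⟩
        G₃ s                                      ≤⟨ m≤m+n (G₃ s) _ ⟩
        G₃ s + sum (updateAt G₃ s (const 0))      ≡⟨ sym (sum-updateAt-0 G₃ s) ⟩
        sum G₃                                    ∎))
        where open ≤-Reasoning

      rest≡0 : sum G₃ ≡ 0
      rest≡0 = trans (sum-cong-≗ G₃≡0) (sum-replicate-zero k)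
        where
        vanish : ∀ (f : Fin k → ℕ) i j → f i ≡ 0 → updateAt f j (const 0) i ≡ 0
        vanish f i j fi≡0 with i ≟F j
        ... | yes refl = updateAt-updates i f
        ... | no i≢j   = trans (updateAt-minimal i j f i≢j) fi≡0
        G₃≡0 : ∀ s → G₃ s ≡ 0
        G₃≡0 s with cover s
        ... | inj₁ refl        = vanish G₂ i l (vanish G₁ i j (updateAt-updates i F))
        ... | inj₂ (inj₁ refl) = vanish G₂ j l (updateAt-updates j G₁)
        ... | inj₂ (inj₂ refl) = updateAt-updates l G₂

      total : sum F ≡ F i + F j + F l
      total = trans ∑F≡ (trans (cong (λ z → F i + F j + F l + z) rest≡0) (+-identityʳ _))

      -- x + y takes more than half of a total that is at most N.
      complement-light : ∀ x y z → sum F ≡ x + y + z → N < 2 * (x + y) → 2 * z ≤ N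
      complement-light x y z eq N<2xy = +-cancelˡ-≤ N _ _ (begin
        N + 2 * z              ≤⟨ +-monoˡ-≤ (2 * z) (<⇒≤ N<2xy) ⟩
        2 * (x + y) + 2 * z    ≡⟨ sym (*-distribˡ-+ 2 (x + y) z) ⟩
        2 * (x + y + z)        ≡⟨ cong (2 *_) (sym eq) ⟩
        2 * sum F              ≤⟨ *-monoʳ-≤ 2 ∑F≤N ⟩
        2 * N                  ≡⟨ cong (λ z → N + z) (+-identityʳ N) ⟩
        N + N                  ∎)
        where open ≤-Reasoning

      light-l : 2 * F l ≤ N
      light-l = complement-light (F i) (F j) (F l) total (¬coprime⇒heavy (≢-sym j≢i) ¬cop-ij)
      light-j : 2 * F j ≤ N
      light-j = complement-light (F i) (F l) (F j) (trans total (lemma (F i) (F j) (F l))) (¬coprime⇒heavy (≢-sym l≢i) ¬cop-il)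
        where
        lemma : ∀ a b c → a + b + c ≡ a + c + b
        lemma = solve-∀
      light-i : 2 * F i ≤ N
      light-i = ≤-trans (*-monoʳ-≤ 2 (i-min j)) light-j

      -- Deficits of at most 1/2 make all denominators coprime to n, hence also some common multiple
      -- R of them. Then n ∣ m R gives n ∣ m, and m / n is irreducible.
      n≡1 : n ≡ 1
      n≡1 with coprime-multiple n b (λ s → coprime-sym (cop s))
        where
        cop : ∀ s → Coprime (b s) n
        cop s with cover s
        ... | inj₁ refl        = light⇒coprime-n light-i
        ... | inj₂ (inj₁ refl) = light⇒coprime-n light-j
        ... | inj₂ (inj₂ refl) = light⇒coprime-n light-l
      ... | R , cop-R , b∣R = m⊥n (coprime-divisor cop-R (subst (n ∣_) (*-comm m R) (n∣mR R b∣R)) , ∣-refl)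

      -- For n = 1 the sum of the deficits, k N - m W, is a multiple of N; it is positive and at
      -- most N.
      ∑F≡N : sum F ≡ N
      ∑F≡N = ≤-antisym ∑F≤N (∣⇒≤ {{>-nonZero (≤-trans (1≤F l) (subst (F l ≤_) (sym total) (m≤n+m (F l) _)))}}
        (∣m+n∣m⇒∣n (subst (N ∣_) (trans (sym ∑F+mW≡kN) (+-comm (sum F) (m * W))) (n∣m*n k)) (∣n⇒∣m*n m N∣W)))
        where
        N∣W : N ∣ W
        N∣W = ∣-reflexive (trans N≡n*W (trans (cong (_* W) n≡1) (*-identityˡ W)))

      -- As F x + F y = N - F z, `common-factor` turns into the bound g F z < N required by
      -- `no-triangle`.
      third : ∀ {x y z} → x ≢ y → F x + F y + F z ≡ N → ∀ g → g ∣ b x → g ∣ b y → g * F z < F i + F j + F l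
      third {x} {y} {z} x≢y eq g g∣x g∣y = +-cancelˡ-< (g * (F x + F y)) _ _ (begin-strict
        g * (F x + F y) + g * F z                ≡⟨ sym (*-distribˡ-+ g (F x + F y) (F z)) ⟩
        g * (F x + F y + F z)                    ≡⟨ cong (g *_) eq ⟩
        g * N                                    <⟨ common-factor x≢y g∣x g∣y ⟩
        N + g * (F x + F y)                      ≡⟨ +-comm N _ ⟩
        g * (F x + F y) + N                      ≡⟨ cong (λ z → g * (F x + F y) + z) (trans (sym ∑F≡N) total) ⟩
        g * (F x + F y) + (F i + F j + F l)      ∎)
        where open ≤-Reasoning

      N∣bF : ∀ s → F i + F j + F l ∣ b s * F s
      N∣bF s = divides (b s ∸ a s) (trans (lemma (b s) (b s ∸ a s) (w s)) (cong ((b s ∸ a s) *_) (trans (w*b≡N s) (trans (sym ∑F≡N) total))))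
        where
        lemma : ∀ b d w → b * (d * w) ≡ d * (w * b)
        lemma = solve-∀

      absurd : ⊥
      absurd = no-triangle (1≤F i) (1≤F j) (1≤F l) (N∣bF i) (N∣bF j) (N∣bF l)
        (third (≢-sym j≢i) F≡N)
        (third (≢-sym l≢j) (trans (rotate (F j) (F l) (F i)) F≡N))
        (third l≢i (trans (trans (rotate (F l) (F i) (F j)) (rotate (F j) (F l) (F i))) F≡N))
        where
        F≡N : F i + F j + F l ≡ N
        F≡N = trans (sym total) ∑F≡N
        rotate : ∀ a b c → a + b + c ≡ c + a + b
        rotate = solve-∀

  no-short-faithful : ⊥
  no-short-faithful =
    let i , i-min = argmin (<⇒≤ 2≤k) F
        j₀ , j₀≢i = ∃≢ 2≤k i
        cop-n : Coprime (b i) n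
        cop-n = light⇒coprime-n (light i j₀ (≢-sym j₀≢i) (i-min j₀))
        -- `j₀` only supplies an index to avoid; avoiding the neighbour j found here then yields a
        -- second one.
        j , j≢i , _ , ¬cop-ij = neighbour i cop-n j₀≢i
        l , l≢i , l≢j , ¬cop-il = neighbour i cop-n j≢i
    in Triple.absurd i-min j≢i l≢i l≢j ¬cop-ij ¬cop-il
    where
    2≤k : 2 ≤ k
    2≤k = *-cancelʳ-≤ 2 k N (≤-trans 2N≤mW (≤-trans (m≤n+m (m * W) (sum F)) (≤-reflexive ∑F+mW≡kN)))
    light : ∀ i j → i ≢ j → F i ≤ F j → 2 * F i ≤ N
    light i j i≢j Fi≤Fj = ≤-trans (+-monoʳ-≤ (F i) (≤-trans (≤-reflexive (+-identityʳ (F i))) Fi≤Fj)) (F+F≤N i≢j)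

-- From rationals to numerators

subValue-common : ∀ {N} .{{_ : NonZero N}} (xs : Vec ℕ k) (ds : Terms k) (w : Fin k → ℕ) →
  (∀ i → w i * proj₂ (lookup ds i) ≡ N) → subValue xs ds ≡ (+ sum (λ i → lookup xs i * w i)) ÷ N
subValue-common {N = N} [] [] w eq = sym (0÷ N)
subValue-common {N = N} (x ∷ xs) ((a , b) ∷ ds) w eq = trans
  (cong₂ _+ℚ_ (÷-congℕ {x} {b} {x * w zero} {N} x*N≡) (subValue-common xs ds (w ∘ suc) (eq ∘ suc)))
  (÷-+-same (x * w zero) (sum (λ i → lookup xs i * w (suc i))) N)
  where
  instance
    b≢0 : NonZero b
    b≢0 = m*n≢0⇒n≢0 (w zero) {{subst NonZero (sym (eq zero)) it}}
  x*N≡ : x * N ≡ x * w zero * b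
  x*N≡ = trans (cong (x *_) (sym (eq zero))) (sym (*-assoc x (w zero) b))

value≡subValue : ∀ (ds : Terms k) → value ds ≡ subValue (map proj₁ ds) ds
value≡subValue []             = refl
value≡subValue ((a , b) ∷ ds) = cong ((+ a) ÷ b +ℚ_) (value≡subValue ds)

faithful⇒long : ∀ {m n t} {ds : Terms k} → 1 ≤ n → Coprime m n → 2 ≤ t → t * n ≤ m →
  IsDecomposition ((+ m) ÷ n) ds → IsFaithful m n ds → t + 2 ≤ k
faithful⇒long {k} {m} {n} {t} {ds} 1≤n m⊥n 2≤t tn≤m (_ , 1≤b , _ , value≡) faithful
  -- The common denominator is N = n R, so that W = R and w i = n (R / b i).
  with common-multiple NonZero _ (λ {x} {y} x≢0 y≢0 → m*n≢0 x y {{x≢0}} {{y≢0}})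
    (proj₂ ∘ lookup ds) (λ i → >-nonZero (1≤b i))
... | R , R≢0 , b∣R = ≮⇒≥ λ k<t+2 → no-short-faithful a b w (>-nonZero⁻¹ N) refl w*b≡N m⊥n
    (trans (sum-cong-≗ λ i → cong (_* w i) (sym (lookup-map i proj₁ ds)))
      (numerator (map proj₁ ds) m (trans (sym (value≡subValue ds)) value≡)))
    (≤-trans (*-monoˡ-≤ N 2≤t) tN≤mR)
    -- k ≤ t + 1 gives k N ≤ N + t N ≤ N + m R.
    (≤-trans (*-monoˡ-≤ N (m<1+n⇒m≤n (≤-trans k<t+2 (≤-reflexive (+-comm t 2))))) (+-monoʳ-≤ N tN≤mR))
    λ x x≤a c eq → ⊎-map
      (λ v≡ → trans (sym (sum-tabulate x)) (numerator (tabulate x) m v≡))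
      (λ v≡ → trans (sym (sum-tabulate x)) (trans (sym (*-identityʳ _))
        (÷-injectiveℕ {t = 0} {e = 1} (trans (sym (common (tabulate x))) v≡))))
      (faithful (tabulate x) (λ i → subst (_≤ a i) (sym (lookup∘tabulate x i)) (x≤a i)) (+ c)
        (trans (common (tabulate x)) (÷-congℕ (trans (cong (_* n) (trans (sum-tabulate x) eq)) (lemma c R n)))))
  where
  N = n * R
  a b w : Fin k → ℕ
  a = proj₁ ∘ lookup ds
  b = proj₂ ∘ lookup ds
  w i = n * _∣_.quotient (b∣R i)
  instance
    n≢0 : NonZero n
    n≢0 = >-nonZero 1≤n
    N≢0 : NonZero N
    N≢0 = m*n≢0 n R {{n≢0}} {{R≢0}}
  w*b≡N : ∀ i → w i * b i ≡ N
  w*b≡N i = trans (*-assoc n _ (b i)) (cong (n *_) (sym (_∣_.equality (b∣R i))))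
  lemma : ∀ c R n → c * R * n ≡ c * (n * R)
  lemma = solve-∀
  ∑ : Vec ℕ k → ℕ
  ∑ xs = sum (λ i → lookup xs i * w i)
  common : ∀ xs → subValue xs ds ≡ (+ ∑ xs) ÷ N
  common xs = subValue-common xs ds w w*b≡N
  sum-tabulate : ∀ x → ∑ (tabulate x) ≡ sum (λ i → x i * w i)
  sum-tabulate x = sum-cong-≗ λ i → cong (_* w i) (lookup∘tabulate x i)
  numerator : ∀ xs c → subValue xs ds ≡ (+ c) ÷ n → ∑ xs ≡ c * R
  numerator xs c v≡ = *-cancelʳ-≡ _ _ n (trans (÷-injectiveℕ (trans (sym (common xs)) v≡)) (sym (lemma c R n)))
  tN≤mR : t * N ≤ m * R
  tN≤mR = ≤-trans (≤-reflexive (sym (*-assoc t n R))) (*-monoˡ-≤ R tn≤m)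

-- h is bounded on a finite list, so an element with larger h lies outside it. With h the first
-- denominator, no finite list exhausts the decompositions.
unbounded⇒∉ : {A : Set} {P : A → Set} (h : A → ℕ) → (∀ K → ∃ λ x → K < h x × P x) →
  ∀ L → ∃ λ x → P x × x ∉ L
unbounded⇒∉ h unbounded L with unbounded (max 0 (List.map h L))
... | x , max<h , Px = x , Px , λ x∈L → <⇒≱ max<h (All.lookup (xs≤max 0 (List.map h L)) (∈-map⁺ h x∈L))

theorem1p1 : ∀ (m n t : ℕ) → 1 ≤ m → 1 ≤ n → Coprime m n → 2 ≤ t →
    (+ t) ÷ 1 ≤ℚ (+ m) ÷ n → (+ m) ÷ n <ℚ (+ (t + 1)) ÷ 1 →
    (∀ (k : ℕ) (ds : Terms k) → IsDecomposition ((+ m) ÷ n) ds → IsFaithful m n ds → t + 2 ≤ k) ×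
    (∀ (L : List (Terms (t + 2))) → ∃ λ (ds : Terms (t + 2)) →
    IsDecomposition ((+ m) ÷ n) ds × IsFaithful m n ds × ds ∉ L)
theorem1p1 m n t@(suc s) 1≤m 1≤n m⊥n 2≤t t≤m/n m/n<t+1 =
  (λ k ds → faithful⇒long 1≤n m⊥n 2≤t tn≤m) ,
  (λ L → let ds , (dec , faithful) , ds∉L = unbounded⇒∉ headDenominator unbounded L
         in ds , dec , faithful , ds∉L)
  where
  instance
    n≢0 : NonZero n
    n≢0 = >-nonZero 1≤n
  tn≤m : t * n ≤ m
  tn≤m = ℤ.drop‿+≤+ (subst₂ ℤ._≤_ (sym (ℤ.pos-* t n)) (ℤ.*-identityʳ (+ m)) (÷-≤ (+ t) 1 (+ m) n t≤m/n))
  m<[t+1]n : m < (t + 1) * n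
  m<[t+1]n = ℤ.drop‿+<+ (subst₂ ℤ._<_ (ℤ.*-identityʳ (+ m)) (sym (ℤ.pos-* (t + 1) n)) (÷-< (+ m) n (+ (t + 1)) 1 m/n<t+1))
  -- r ≥ 1 amounts to m / n < t + 1, and r ≤ n to t ≤ m / n.
  r = (t + 1) * n ∸ m
  m+r≡ : m + r ≡ n * (2 + s)
  m+r≡ = trans (m+[n∸m]≡n (<⇒≤ m<[t+1]n)) (lemma s n)
    where
    lemma : ∀ s n → (suc s + 1) * n ≡ n * (2 + s)
    lemma = solve-∀
  r≤n : r ≤ n
  r≤n = m≤n+o⇒m∸n≤o _ m (≤-trans (≤-reflexive (lemma t n)) (+-monoˡ-≤ n tn≤m))
    where
    lemma : ∀ t n → (t + 1) * n ≡ t * n + n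
    lemma = solve-∀
  unbounded : ∀ K → ∃ λ (ds : Terms (t + 2)) → K < headDenominator ds × IsDecomposition ((+ m) ÷ n) ds × IsFaithful m n ds
  unbounded K = subst
    (λ l → ∃ λ (ds : Terms l) → K < headDenominator ds × IsDecomposition ((+ m) ÷ n) ds × IsFaithful m n ds)
    (+-comm 2 t) (unbounded-decompositions s r K 1≤n m⊥n (m<n⇒0<n∸m m<[t+1]n) r≤n m+r≡)
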